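{- For the online algorithm described in the context, whether its non-isolated part uses MNF or MFF, the approximation factor $(3,1.7)$ is tight: for every $\delta>0$ there are a choice of $\varepsilon=2^{ -j}$ and instances with all item sizes at least $\varepsilon$ and arbitrarily large $\mathrm{OPT}(I)$ on which the algorithm uses at least $(3-\delta)\mathrm{OPT}(I)$ bins, and there are instances containing a colour $c$ with arbitrarily large $\mathrm{OPT}(I_c)$ on which $P_c(I)\ge(1.7-\delta)\mathrm{OPT}(I_c)$.
   Context: Online coloured bin packing: items arrive one by one, each with size $s(e)\in[\varepsilon,1]$ and colour $c(e)\in\{1,\dots,m\}$, placed irrevocably into unit-capacity bins. $I_c$ is the set of colour-$c$ items; $\mathrm{OPT}(I)$, $\mathrm{OPT}(I_c)$ are offline minimum numbers of bins for $I$, $I_c$; $P(I)$ is the number of bins used and $P_c(I)$ the number of bins containing a colour-$c$ item. Here $\varepsilon=2^{ -j}$, $j$ a positive integer. For $i=1,\dots,j$, a level-$i$ bin is divided into exactly $1/(2^i\varepsilon)$ regions each of size $2^i\varepsilon$ (level-$i$ regions); each region contains items of at most one colour. Modified Next Fit (MNF) packs item $e$ of colour $c$: let $i$ be the highest level at which an item of colour $c$ is packed ($i=1$ for the first item of $c$); if $e$ fits in colour $c$'s level-$i$ region, pack it there; otherwise let $l>i$ be the lowest level with $2^l\varepsilon\ge s(e)$ and pack $e$ into a new level-$l$ region (creating a new level-$l$ bin if needed). Modified First Fit (MFF) is identical except that $i$ is taken to be the lowest level whose region occupied by colour $c$ has space for $e$ (so $e$ is tried in each region already used by $c$). A colour has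 level $i$ if $i$ is the largest level of a bin containing its items. The algorithm packs an item of colour $c$ with MNF (resp. MFF) into these non-isolated bins while $c$ has level $<j$, and otherwise with Bounded Best-Fit (at most 2 open bins; best fit among open bins, else close the fullest open bin and open a new one) into isolated bins containing only colour $c$ (the last level-$j$ bin of $c$ also counts as isolated). -}

module Defs where

open import Data.Bool using (Bool; true; false; if_then_else_; not; _∧_; _∨_)
open import Data.Nat as ℕ using (ℕ; zero; suc; _∸_; _^_; _≡ᵇ_; _<ᵇ_)
open import Data.Integer using (+_)
open import Data.Rational using (ℚ; 0ℚ; 1ℚ; ½; _+_; _*_; _≤ᵇ_; _≤_; _/_)
open import Data.List using (List; []; _∷_; _++_; length; filter; foldl; foldr; map)
open import Data.Bool.ListAction using (any)
open import Data.Maybe using (Maybe; just; nothing)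
open import Data.Product using (_×_; _,_; proj₁; proj₂; Σ)
open import Relation.Binary.PropositionalEquality using (_≡_)

record Item : Set where
  constructor item
  field
    size   : ℚ
    colour : ℕ
open Item public

Instance : Set
Instance = List Item

toℚ : ℕ → ℚ
toℚ n = + n / 1

eps : ℕ → ℚ
eps zero    = 1ℚ
eps (suc j) = ½ * eps j

twoPow : ℕ → ℚ
twoPow zero    = 1ℚ
twoPow (suc i) = toℚ 2 * twoPow i

regionSize : ℕ → ℕ → ℚ
regionSize j i = twoPow i * eps j

SizesIn : ℕ → Instance → Set
SizesIn j [] = Data.Unit.⊤ where import Data.Unit
SizesIn j (e ∷ I) = (eps j ≤ size e × size e ≤ 1ℚ) × SizesIn j I

colourPart : ℕ → Instance → Instance
colourPart c = filter (λ e → Data.Nat.Properties._≟_ (colour e) c)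
  where import Data.Nat.Properties

loadOf : ℕ → List ℕ → Instance → ℚ
loadOf b (x ∷ a) (e ∷ I) = (if x ≡ᵇ b then size e else 0ℚ) + loadOf b a I
loadOf b _ _ = 0ℚ

Packable : Instance → ℕ → Set
Packable I k = Σ (List ℕ) λ a →
  (length a ≡ length I) × ((x : ℕ) → x Data.List.Membership.Propositional.∈ a → x ℕ.< k)
    × ((b : ℕ) → loadOf b a I ≤ 1ℚ)
  where import Data.List.Membership.Propositional

IsOPT : Instance → ℕ → Set
IsOPT I o = Packable I o × ((k : ℕ) → Packable I k → o ℕ.≤ k)

data Kind : Set where
  lvl : ℕ → Kind     -- non-isolated level-i bin (1 ≤ i < j)
  iso : Bool → Kind  -- isolated bin (only one colour); flag = still open for Bounded Best-Fit

record Region : Set where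
  constructor reg
  field
    col  : ℕ
    load : ℚ
open Region public

record Bin : Set where
  constructor bin
  field
    kind    : Kind
    regions : List Region
open Bin public

State : Set
State = List Bin

data Variant : Set where
  MNF MFF : Variant

_<ᵠ_ : ℚ → ℚ → Bool
p <ᵠ q = not (q ≤ᵇ p)

hasColour : ℕ → Bin → Bool
hasColour c b = any (λ r → col r ≡ᵇ c) (regions b)

isLvl : ℕ → Kind → Bool
isLvl l (lvl i) = i ≡ᵇ l
isLvl l (iso _) = false

isIsoOpen : Kind → Bool
isIsoOpen (lvl _)   = false
isIsoOpen (iso o)   = o

isIso : Kind → Bool
isIso (lvl _) = false
isIso (iso _) = true

binLoad : Bin → ℚ
binLoad b = foldr (λ r q → load r + q) 0ℚ (regions b)

-- colour c is served by Bounded Best-Fit iff it has reached level j,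
-- i.e. it owns an isolated bin (a level-j region is a whole bin)
inBBF : ℕ → State → Bool
inBBF c = any (λ b → isIso (kind b) ∧ hasColour c b)

levelsOf : ℕ → State → List ℕ
levelsOf c [] = []
levelsOf c (bin (lvl i) rs ∷ st) =
  (if any (λ r → col r ≡ᵇ c) rs then i ∷ [] else []) ++ levelsOf c st
levelsOf c (bin (iso _) rs ∷ st) = levelsOf c st

maxList : List ℕ → ℕ
maxList = foldr ℕ._⊔_ 0

regionLoad : ℕ → ℕ → State → ℚ
regionLoad c l [] = 0ℚ
regionLoad c l (bin k rs ∷ st) =
  if isLvl l k ∧ any (λ r → col r ≡ᵇ c) rs then go rs else regionLoad c l st
  where
  go : List Region → ℚ
  go [] = 0ℚ
  go (r ∷ rs) = if col r ≡ᵇ c then load r else go rs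

addToRegion : ℕ → ℕ → ℚ → State → State
addToRegion c l s [] = []
addToRegion c l s (bin k rs ∷ st) =
  if isLvl l k ∧ any (λ r → col r ≡ᵇ c) rs then bin k (go rs) ∷ st
  else bin k rs ∷ addToRegion c l s st
  where
  go : List Region → List Region
  go [] = []
  go (r ∷ rs) = if col r ≡ᵇ c then reg (col r) (load r + s) ∷ rs else r ∷ go rs

fits : ℕ → ℚ → ℚ → ℕ → Bool
fits j s ld i = (ld + s) ≤ᵇ regionSize j i

lowestLevel : ℕ → ℚ → ℕ → ℕ
lowestLevel j s from = go (j ∸ from) from
  where
  go : ℕ → ℕ → ℕ
  go zero cur = cur
  go (suc f) cur = if s ≤ᵇ regionSize j cur then cur else go f (suc cur)

-- put an item (c, s) into a new level-l region; a level-j region is a whole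
-- bin, which becomes colour c's first (open) isolated bin.  Otherwise use the
-- first level-l bin with an unused region, else open a new level-l bin.
newRegion : ℕ → ℕ → ℕ → ℚ → State → State
newRegion j c l s st =
  if l ≡ᵇ j then st ++ (bin (iso true) (reg c s ∷ []) ∷ []) else go st
  where
  go : State → State
  go [] = bin (lvl l) (reg c s ∷ []) ∷ []
  go (bin k rs ∷ st') =
    if isLvl l k ∧ (length rs <ᵇ 2 ^ (j ∸ l))
    then bin k (rs ++ reg c s ∷ []) ∷ st'
    else bin k rs ∷ go st'

-- Bounded Best-Fit (per colour, at most two open isolated bins)

enumerate : {A : Set} → ℕ → List A → List (ℕ × A)
enumerate n [] = []
enumerate n (x ∷ xs) = (n , x) ∷ enumerate (suc n) xs

argmax : List (ℕ × ℚ) → Maybe ℕ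
argmax [] = nothing
argmax ((i , x) ∷ xs) = just (go i x xs)
  where
  go : ℕ → ℚ → List (ℕ × ℚ) → ℕ
  go i x [] = i
  go i x ((k , y) ∷ ys) = if x <ᵠ y then go k y ys else go i x ys

modifyAt : ℕ → (Bin → Bin) → State → State
modifyAt n f [] = []
modifyAt zero f (b ∷ bs) = f b ∷ bs
modifyAt (suc n) f (b ∷ bs) = b ∷ modifyAt n f bs

openBinsOf : ℕ → State → List (ℕ × ℚ)
openBinsOf c st =
  map (λ p → proj₁ p , binLoad (proj₂ p))
      (filter (λ p → Data.Bool.Properties.T? (isIsoOpen (kind (proj₂ p)) ∧ hasColour c (proj₂ p)))
              (enumerate 0 st))
  where import Data.Bool.Properties

addToBin : ℕ → ℚ → Bin → Bin
addToBin c s (bin k rs) = bin k (map (λ r → reg (col r) (load r + s)) rs)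

closeBin : Bin → Bin
closeBin (bin _ rs) = bin (iso false) rs

bbfStep : ℕ → ℚ → State → State
bbfStep c s st with argmax (filter (λ p → Data.Bool.Properties.T? ((proj₂ p + s) ≤ᵇ 1ℚ)) (openBinsOf c st))
  where import Data.Bool.Properties
... | just n  = modifyAt n (addToBin c s) st
... | nothing = closed ++ (bin (iso true) (reg c s ∷ []) ∷ [])
  where
  opens = openBinsOf c st
  closed : State
  closed with 2 ℕ.≤ᵇ length opens | argmax opens
  ... | true  | just n = modifyAt n closeBin st
  ... | _     | _      = st

step : Variant → ℕ → State → Item → State
step v j st e with inBBF c st | levelsOf c st
  where c = colour e
... | true  | _  = bbfStep (colour e) (size e) st
... | false | [] = newRegion j (colour e) (lowestLevel j (size e) 1) (size e) st
... | false | ls@(_ ∷ _) = mode v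
  where
  c = colour e
  s = size e
  top = maxList ls
  fitsAt : ℕ → Bool
  fitsAt i = fits j s (regionLoad c i st) i
  minFit : List ℕ → Maybe ℕ
  minFit [] = nothing
  minFit (i ∷ is) with fitsAt i | minFit is
  ... | false | m = m
  ... | true  | nothing = just i
  ... | true  | just k = just (i ℕ.⊓ k)
  mode : Variant → State
  mode MNF = if fitsAt top then addToRegion c top s st
             else newRegion j c (lowestLevel j s (suc top)) s st
  mode MFF with minFit ls
  ... | just i  = addToRegion c i s st
  ... | nothing = newRegion j c (lowestLevel j s (suc top)) s st

run : Variant → ℕ → Instance → State
run v j = foldl (step v j) []

P : Variant → ℕ → Instance → ℕ
P v j I = length (run v j I)

Pc : Variant → ℕ → Instance → ℕ → ℕ
Pc v j I c = length (filter (λ b → Data.Bool.Properties.T? (hasColour c b)) (run v j I))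
  where import Data.Bool.Properties

{-# OPTIONS --safe #-}
module Submission where

-- Factor 3.  With ε = 2 ^ -j let every colour send items e_1, …, e_(j-1), where e_l is just above a
-- third of the level-l region size 2 ^ l ε.  Then e_(k+1) overflows every region its colour holds at a
-- level l ≤ k, so the colour occupies one region on each of the levels 1, …, j - 1, that is
-- 1 - 2 / 2 ^ j of a bin in total, while its items sum to 1/3: three colours fill one optimal bin.
--
-- Factor 1.7.  As long as no item fits an earlier bin, Bounded Best-Fit makes no real choice.  Small
-- items (1/6 ± …) fill bins in fives to just above 5/6, then medium items (1/3 ± …) fill bins in pairs
-- to just above 2/3, then large items (1/2 + …) come alone, whereas one item of each kind fills an
-- optimal bin exactly.  As in the classical First-Fit example the perturbations come in blocks of ten
-- at geometrically decreasing scales: the excess over 5/6 or 2/3 left by one block need only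
-- beat the negative perturbations of the next, and the large positive medium perturbation that
-- opens a block is matched with a small item of the previous block.

-- Both statements need the exact value of OPT, so both instances are perfect packings: every bin of
-- the intended packing is full, and total volume rules out fewer bins. This exactness dictates the
-- constants. A third of the level-1 region 2 ε is below the permitted minimum ε, so e_1 has to be ε
-- itself. With ε worth 3 e units and j = e + 2, each of the e remaining items exceeds a third of
-- its region by one unit. These e units and the 3 e of the first item make up exactly the 4 e units
-- that the geometric sum lacks for a third of a bin.
--
-- The two variants never have to be told apart. In the ladder a new item overflows all regions of
-- its colour, so MNF and MFF both open a new one. In the other instance a first item of size 1
-- takes the colour to level j at once, so neither of them packs anything further. There the chain
-- of medium items, each block handing its last item to the next, has two loose ends; two items of
-- size 1/2 tie them up at the cost of one optimal bin.
--
-- The arrangement of regions inside the level bins is not followed. Only their total area is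
-- counted, which bounds the number of bins from below.

open import Defs

-- Fractions over a common denominator

module Fractions where
  open import Data.Bool using (true; false; T)
  open import Data.Nat
  open import Data.Nat.Properties
  import Data.Integer as ℤ
  import Data.Integer.Properties as ℤₚ
  open import Data.Rational as ℚ using (ℚ; 0ℚ; 1ℚ; toℚᵘ)
  import Data.Rational.Properties as ℚₚ
  open import Data.Rational.Unnormalised as ℚᵘ using (mkℚᵘ; *≡*; *≤*; *<*)
  import Data.Rational.Unnormalised.Properties as ℚᵘₚ
  open import Data.Empty using (⊥-elim)
  open import Data.Unit using (tt)
  open import Relation.Nullary using (¬_)
  open import Relation.Binary.PropositionalEquality

  infix 8 _÷_

  -- `/` reduces to lowest terms by a gcd, while all sizes below share one denominator. Opacity
  -- keeps the gcd from unfolding, so that the proofs use only the laws that follow and all real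
  -- arithmetic takes place in ℕ.
  opaque
    _÷_ : ℕ → (d : ℕ) → .{{NonZero d}} → ℚ
    n ÷ d = ℤ.+ n ℚ./ d

  opaque
    unfolding _÷_

    toℚᵘ-÷ : ∀ n d-1 → toℚᵘ (n ÷ suc d-1) ℚᵘ.≃ mkℚᵘ (ℤ.+ n) d-1
    toℚᵘ-÷ n d-1 = ℚₚ.toℚᵘ-fromℚᵘ (mkℚᵘ (ℤ.+ n) d-1)

    ÷-cross : ∀ a b c d .{{_ : NonZero b}} .{{_ : NonZero d}} → a * d ≡ c * b → a ÷ b ≡ c ÷ d
    ÷-cross a (suc b) c (suc d) eq = ℚₚ.fromℚᵘ-cong {mkℚᵘ (ℤ.+ a) b} {mkℚᵘ (ℤ.+ c) d}
      (*≡* (trans (sym (ℤₚ.pos-* a (suc d))) (trans (cong ℤ.+_ eq) (ℤₚ.pos-* c (suc b)))))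

    ÷-+ : ∀ a b d .{{_ : NonZero d}} → a ÷ d ℚ.+ b ÷ d ≡ (a + b) ÷ d
    ÷-+ a b (suc d) = ℚₚ.toℚᵘ-injective (begin
      toℚᵘ (a ÷ suc d ℚ.+ b ÷ suc d)                 ≈⟨ ℚₚ.toℚᵘ-homo-+ (a ÷ suc d) (b ÷ suc d) ⟩
      toℚᵘ (a ÷ suc d) ℚᵘ.+ toℚᵘ (b ÷ suc d)         ≈⟨ ℚᵘₚ.+-cong (toℚᵘ-÷ a d) (toℚᵘ-÷ b d) ⟩
      mkℚᵘ (ℤ.+ a) d ℚᵘ.+ mkℚᵘ (ℤ.+ b) d             ≈⟨ *≡* (eq (ℤ.+ suc d)) ⟩
      mkℚᵘ (ℤ.+ (a + b)) d                           ≈⟨ toℚᵘ-÷ (a + b) d ⟨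
      toℚᵘ ((a + b) ÷ suc d)                         ∎)
      where
      open ℚᵘₚ.≃-Reasoning
      eq : ∀ D → (ℤ.+ a ℤ.* D ℤ.+ ℤ.+ b ℤ.* D) ℤ.* D ≡ ℤ.+ (a + b) ℤ.* (D ℤ.* D)
      eq D = trans (cong (ℤ._* D) (sym (ℤₚ.*-distribʳ-+ D (ℤ.+ a) (ℤ.+ b)))) (ℤₚ.*-assoc (ℤ.+ (a + b)) D D)

    ÷-* : ∀ a b c d .{{_ : NonZero b}} .{{_ : NonZero d}} .{{_ : NonZero (b * d)}} →
      a ÷ b ℚ.* c ÷ d ≡ (a * c) ÷ (b * d)
    ÷-* a (suc b) c (suc d) = ℚₚ.toℚᵘ-injective (begin
      toℚᵘ (a ÷ suc b ℚ.* c ÷ suc d)                 ≈⟨ ℚₚ.toℚᵘ-homo-* (a ÷ suc b) (c ÷ suc d) ⟩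
      toℚᵘ (a ÷ suc b) ℚᵘ.* toℚᵘ (c ÷ suc d)         ≈⟨ ℚᵘₚ.*-cong (toℚᵘ-÷ a b) (toℚᵘ-÷ c d) ⟩
      mkℚᵘ (ℤ.+ a) b ℚᵘ.* mkℚᵘ (ℤ.+ c) d             ≈⟨ *≡* (cong (ℤ._* (ℤ.+ suc (d + b * suc d))) (sym (ℤₚ.pos-* a c))) ⟩
      mkℚᵘ (ℤ.+ (a * c)) (d + b * suc d)             ≈⟨ toℚᵘ-÷ (a * c) (d + b * suc d) ⟨
      toℚᵘ ((a * c) ÷ (suc b * suc d))               ∎)
      where open ℚᵘₚ.≃-Reasoning

    ÷-mono-≤ : ∀ {a b} d .{{_ : NonZero d}} → a ≤ b → a ÷ d ℚ.≤ b ÷ d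
    ÷-mono-≤ {a} {b} (suc d) a≤b = ℚₚ.toℚᵘ-cancel-≤
      (ℚᵘₚ.≤-respˡ-≃ (ℚᵘₚ.≃-sym (toℚᵘ-÷ a d)) (ℚᵘₚ.≤-respʳ-≃ (ℚᵘₚ.≃-sym (toℚᵘ-÷ b d))
        (*≤* (ℤₚ.*-monoʳ-≤-nonNeg (ℤ.+ suc d) (ℤ.+≤+ a≤b)))))

    ÷-mono-< : ∀ {a b} d .{{_ : NonZero d}} → a < b → a ÷ d ℚ.< b ÷ d
    ÷-mono-< {a} {b} (suc d) a<b = ℚₚ.toℚᵘ-cancel-<
      (ℚᵘₚ.<-respˡ-≃ (ℚᵘₚ.≃-sym (toℚᵘ-÷ a d)) (ℚᵘₚ.<-respʳ-≃ (ℚᵘₚ.≃-sym (toℚᵘ-÷ b d))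
        (*<* (ℤₚ.*-monoʳ-<-pos (ℤ.+ suc d) (ℤ.+<+ a<b)))))

    ÷-def : ∀ n d .{{_ : NonZero d}} → n ÷ d ≡ ℤ.+ n ℚ./ d
    ÷-def n d = refl

    d÷d≡1 : ∀ d .{{_ : NonZero d}} → d ÷ d ≡ 1ℚ
    d÷d≡1 d = ÷-cross d d 1 1 (*-comm d 1)

    0÷ : ∀ d .{{_ : NonZero d}} → 0 ÷ d ≡ 0ℚ
    0÷ d = ÷-cross 0 d 0 1 refl

  <⇒≱ℚ : ∀ {p q} → p ℚ.< q → ¬ (q ℚ.≤ p)
  <⇒≱ℚ p<q q≤p = ℚₚ.<-irrefl refl (ℚₚ.<-≤-trans p<q q≤p)

  ÷-cancel-≤ : ∀ {a b} d .{{_ : NonZero d}} → a ÷ d ℚ.≤ b ÷ d → a ≤ b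
  ÷-cancel-≤ {a} {b} d a≤b = ≮⇒≥ (λ b<a → <⇒≱ℚ (÷-mono-< d b<a) a≤b)

  T⇒≡true : ∀ {b} → T b → b ≡ true
  T⇒≡true {true} _ = refl

  ≡true⇒T : ∀ {b} → b ≡ true → T b
  ≡true⇒T refl = tt

  ¬T⇒≡false : ∀ {b} → ¬ T b → b ≡ false
  ¬T⇒≡false {false} _  = refl
  ¬T⇒≡false {true}  ¬t = ⊥-elim (¬t tt)

  ≤ᵇ-true : ∀ {p q} → p ℚ.≤ q → (p ℚ.≤ᵇ q) ≡ true
  ≤ᵇ-true p≤q = T⇒≡true (ℚₚ.≤⇒≤ᵇ p≤q)

  ≤ᵇ-false : ∀ {p q} → q ℚ.< p → (p ℚ.≤ᵇ q) ≡ false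
  ≤ᵇ-false {p} {q} q<p = ¬T⇒≡false (λ t → <⇒≱ℚ q<p (ℚₚ.≤ᵇ⇒≤ t))

  k*d÷d : ∀ k d .{{_ : NonZero d}} → (k * d) ÷ d ≡ toℚ k
  k*d÷d k d = trans (÷-cross (k * d) d k 1 (*-identityʳ (k * d))) (÷-def k 1)

  twoPow≡ : ∀ i → twoPow i ≡ (2 ^ i) ÷ 1
  twoPow≡ zero    = sym (d÷d≡1 1)
  twoPow≡ (suc i) = trans (cong₂ ℚ._*_ (sym (÷-def 2 1)) (twoPow≡ i)) (÷-* 2 1 (2 ^ i) 1)

  eps≡ : ∀ j .{{_ : NonZero (2 ^ j)}} → eps j ≡ 1 ÷ (2 ^ j)
  eps≡ zero    = sym (d÷d≡1 1)
  eps≡ (suc j) = trans (cong₂ ℚ._*_ (sym (÷-def 1 2)) (eps≡ j)) (÷-* 1 2 1 (2 ^ j))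
    where
    instance
      2^j≢0 : NonZero (2 ^ j)
      2^j≢0 = m^n≢0 2 j

  eps-scaled : ∀ j u .{{_ : NonZero (2 ^ j * u)}} → eps j ≡ u ÷ (2 ^ j * u)
  eps-scaled j u = trans (eps≡ j) (÷-cross 1 (2 ^ j) u (2 ^ j * u) (trans (*-identityˡ _) (*-comm (2 ^ j) u)))
    where
    instance
      2^j≢0 : NonZero (2 ^ j)
      2^j≢0 = m^n≢0 2 j

  -- The factor `u` is the number of units in ε; it is free, so that fractions of a region such as a
  -- third can be made integral.
  regionSize-scaled : ∀ j i u .{{_ : NonZero (2 ^ j * u)}} →
    regionSize j i ≡ (2 ^ i * u) ÷ (2 ^ j * u)
  regionSize-scaled j i u = trans (cong₂ ℚ._*_ (twoPow≡ i) (eps-scaled j u))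
    (trans (÷-* (2 ^ i) 1 u (2 ^ j * u))
      (÷-cross (2 ^ i * u) (1 * (2 ^ j * u)) (2 ^ i * u) (2 ^ j * u)
        (cong (2 ^ i * u *_) (sym (*-identityˡ (2 ^ j * u))))))
    where
    instance
      1*D≢0 : NonZero (1 * (2 ^ j * u))
      1*D≢0 = m*n≢0 1 (2 ^ j * u)

-- Perfect packings and the exact value of OPT

module Packings where
  open import Data.Bool using (true; false; if_then_else_)
  open import Data.Nat
  open import Data.Nat.Properties
  import Data.Rational as ℚ
  import Data.Rational.Properties as ℚₚ
  open import Data.List using (List; []; _∷_; map; length)
  open import Data.List.Properties using (length-map)
  open import Data.List.Relation.Unary.All as All using (All; []; _∷_)
  open import Data.List.Relation.Unary.Any using (here; there)
  open import Data.List.Membership.Propositional using (_∈_)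
  open import Data.Product using (_,_)
  open import Data.Sum using (inj₁; inj₂)
  open import Data.Empty using (⊥-elim)
  open import Relation.Binary.PropositionalEquality as ≡ using (_≡_; _≢_; refl; sym; cong; cong₂; subst)
  open import Relation.Nullary using (yes; no)
  open import Data.Nat.Tactic.RingSolver using (solve-∀)
  open Fractions

  -- `target` is the bin of the intended optimal packing. The algorithm never sees it, since
  -- `toItem` forgets it.
  record Job : Set where
    constructor job
    field
      target  : ℕ
      jcolour : ℕ
      units   : ℕ
  open Job public

  weight : (ℕ → ℕ) → List Job → ℕ
  weight w []      = 0
  weight w (x ∷ T) = w (target x) * units x + weight w T

  Σ< : ℕ → (ℕ → ℕ) → ℕ
  Σ< zero    f = 0
  Σ< (suc k) f = Σ< k f + f k

  Σ<-+ : ∀ k f g → Σ< k (λ b → f b + g b) ≡ Σ< k f + Σ< k g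
  Σ<-+ zero    f g = refl
  Σ<-+ (suc k) f g = ≡.trans (cong (_+ (f k + g k)) (Σ<-+ k f g)) (shuffle (Σ< k f) (Σ< k g) (f k) (g k))
    where
    shuffle : ∀ a b c d → a + b + (c + d) ≡ a + c + (b + d)
    shuffle = solve-∀

  Σ<-zero : ∀ k f → (∀ b → b < k → f b ≡ 0) → Σ< k f ≡ 0
  Σ<-zero zero    f f≡0 = refl
  Σ<-zero (suc k) f f≡0 = cong₂ _+_ (Σ<-zero k f (λ b b<k → f≡0 b (m<n⇒m<1+n b<k))) (f≡0 k (n<1+n k))

  Σ<-const : ∀ k c → Σ< k (λ _ → c) ≡ k * c
  Σ<-const zero    c = refl
  Σ<-const (suc k) c = ≡.trans (cong (_+ c) (Σ<-const k c)) (+-comm (k * c) c)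

  Σ<-mono : ∀ k {f g} → (∀ b → f b ≤ g b) → Σ< k f ≤ Σ< k g
  Σ<-mono zero    f≤g = z≤n
  Σ<-mono (suc k) f≤g = +-mono-≤ (Σ<-mono k f≤g) (f≤g k)

  when : ℕ → ℕ → ℕ → ℕ
  when x s b = if x ≡ᵇ b then s else 0

  ≡ᵇ-refl : ∀ x → (x ≡ᵇ x) ≡ true
  ≡ᵇ-refl x = T⇒≡true (≡⇒≡ᵇ x x refl)

  ≢⇒≡ᵇ-false : ∀ {x y} → x ≢ y → (x ≡ᵇ y) ≡ false
  ≢⇒≡ᵇ-false {x} {y} x≢y = ¬T⇒≡false (λ t → x≢y (≡ᵇ⇒≡ x y t))

  when-refl : ∀ x s → when x s x ≡ s
  when-refl x s rewrite ≡ᵇ-refl x = refl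

  when-≢ : ∀ {x b} s → x ≢ b → when x s b ≡ 0
  when-≢ s x≢b rewrite ≢⇒≡ᵇ-false x≢b = refl

  Σ<-when : ∀ k x s → x < k → Σ< k (when x s) ≡ s
  Σ<-when (suc k) x s x<1+k with m≤n⇒m<n∨m≡n (s≤s⁻¹ x<1+k)
  ... | inj₁ x<k  = ≡.trans (cong₂ _+_ (Σ<-when k x s x<k) (when-≢ s (<⇒≢ x<k))) (+-identityʳ s)
  ... | inj₂ refl = cong₂ _+_ (Σ<-zero k (when k s) (λ b b<k → when-≢ s (λ k≡b → <⇒≢ b<k (sym k≡b)))) (when-refl k s)

  indicator : ℕ → ℕ → ℕ
  indicator b x = when x 1 b

  Σ<-indicator≤1 : ∀ k b → Σ< k (indicator b) ≤ 1
  Σ<-indicator≤1 k b with b <? k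
  ... | yes b<k = ≤-reflexive (≡.trans (Σ<-cong k) (Σ<-when k b 1 b<k))
    where
    symm : ∀ x → indicator b x ≡ when b 1 x
    symm x with x ≟ b
    ... | yes refl = refl
    ... | no x≢b   = ≡.trans (when-≢ 1 x≢b) (sym (when-≢ 1 (λ b≡x → x≢b (sym b≡x))))
    Σ<-cong : ∀ k → Σ< k (indicator b) ≡ Σ< k (when b 1)
    Σ<-cong zero    = refl
    Σ<-cong (suc k) = cong₂ _+_ (Σ<-cong k) (symm k)
  ... | no b≮k  = ≤-trans (≤-reflexive (Σ<-zero k (indicator b)
      (λ x x<k → when-≢ 1 (λ x≡b → b≮k (subst (_< k) x≡b x<k))))) z≤n

  totalUnits : List Job → ℕ
  totalUnits = weight (λ _ → 1)

  unitsIn : ℕ → List ℕ → List Job → ℕ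
  unitsIn b (x ∷ a) (t ∷ T) = when x (units t) b + unitsIn b a T
  unitsIn b _       _       = 0

  Σ<-unitsIn : ∀ k a T → length a ≡ length T → (∀ x → x ∈ a → x < k) →
    Σ< k (λ b → unitsIn b a T) ≡ totalUnits T
  Σ<-unitsIn k []      []      len a<k = Σ<-zero k _ (λ _ _ → refl)
  Σ<-unitsIn k (x ∷ a) (t ∷ T) len a<k = ≡.trans (Σ<-+ k (when x (units t)) (λ b → unitsIn b a T))
    (cong₂ _+_ (≡.trans (Σ<-when k x (units t) (a<k x (here refl))) (sym (+-identityʳ (units t))))
      (Σ<-unitsIn k a T (suc-injective len) (λ y y∈a → a<k y (there y∈a))))

  unitsIn-targets : ∀ b T → unitsIn b (map target T) T ≡ weight (indicator b) T
  unitsIn-targets b []      = refl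
  unitsIn-targets b (t ∷ T) = cong₂ _+_ (lemma (target t ≡ᵇ b)) (unitsIn-targets b T)
    where
    lemma : ∀ c → (if c then units t else 0) ≡ (if c then 1 else 0) * units t
    lemma true  = sym (+-identityʳ (units t))
    lemma false = refl

  -- A sum of naturals vanishes only termwise. Applied to a weight that is 1 outside the intended
  -- bins, this shows that no job is sent there.
  weight≡0 : ∀ w T → All (λ t → 0 < units t) T → weight w T ≡ 0 → ∀ x → x ∈ map target T → w x ≡ 0
  weight≡0 w (t ∷ T) (0<u ∷ pos) w≡0 x (there x∈) = weight≡0 w T pos (m+n≡0⇒n≡0 (w (target t) * units t) w≡0) x x∈
  weight≡0 w (t ∷ T) (0<u ∷ pos) w≡0 x (here refl) with m*n≡0⇒m≡0∨n≡0 (w (target t)) (m+n≡0⇒m≡0 (w (target t) * units t) w≡0)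
  ... | inj₁ w≡0′ = w≡0′
  ... | inj₂ u≡0  = ⊥-elim (<⇒≢ 0<u (sym u≡0))

  module _ (D : ℕ) .{{_ : NonZero D}} where

    toItem : Job → Item
    toItem t = item (units t ÷ D) (jcolour t)

    toItems : List Job → Instance
    toItems = map toItem

    loadOf-÷ : ∀ b a T → loadOf b a (toItems T) ≡ unitsIn b a T ÷ D
    loadOf-÷ b []      T       = sym (0÷ D)
    loadOf-÷ b (x ∷ a) []      = sym (0÷ D)
    loadOf-÷ b (x ∷ a) (t ∷ T) = ≡.trans (cong₂ ℚ._+_ (lemma (x ≡ᵇ b)) (loadOf-÷ b a T))
      (÷-+ (when x (units t) b) (unitsIn b a T) D)
      where
      lemma : ∀ c → (if c then units t ÷ D else ℚ.0ℚ) ≡ (if c then units t else 0) ÷ D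
      lemma true  = refl
      lemma false = sym (0÷ D)

    -- Testing all weights w at once says that every one of the K bins is filled exactly
    -- and that no other bin is used; it is insensitive to the order of arrival.
    PerfectPacking : ℕ → List Job → Set
    PerfectPacking K T = ∀ w → weight w T ≡ D * Σ< K w

    -- Three test weights suffice: `beyond` confines the targets to the first `K` bins, the
    -- indicator of a bin bounds its load, and the constant 1 gives total size `K`, too much for
    -- fewer bins of capacity 1.
    perfect⇒OPT : ∀ K T → All (λ t → 0 < units t) T → PerfectPacking K T → IsOPT (toItems T) K
    perfect⇒OPT K T pos perfect = (map target T , lengths , targets<K , loads≤1) , minimal
      where
      lengths : length (map target T) ≡ length (toItems T)
      lengths = ≡.trans (length-map target T) (sym (length-map toItem T))

      beyond : ℕ → ℕ
      beyond x = if x <ᵇ K then 0 else 1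

      beyond≡0 : ∀ x → x < K → beyond x ≡ 0
      beyond≡0 x x<K rewrite T⇒≡true (<⇒<ᵇ x<K) = refl

      beyond≡0⁻¹ : ∀ x → beyond x ≡ 0 → x < K
      beyond≡0⁻¹ x eq with x <ᵇ K in lt
      ... | true  = <ᵇ⇒< x K (≡true⇒T lt)

      targets<K : ∀ x → x ∈ map target T → x < K
      targets<K x x∈ = beyond≡0⁻¹ x (weight≡0 beyond T pos
        (≡.trans (perfect beyond) (≡.trans (cong (D *_) (Σ<-zero K beyond beyond≡0)) (*-zeroʳ D))) x x∈)

      loads≤1 : ∀ b → loadOf b (map target T) (toItems T) ℚ.≤ ℚ.1ℚ
      loads≤1 b = ℚₚ.≤-trans (ℚₚ.≤-reflexive (loadOf-÷ b (map target T) T))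
        (ℚₚ.≤-trans (÷-mono-≤ D bound) (ℚₚ.≤-reflexive (d÷d≡1 D)))
        where
        bound : unitsIn b (map target T) T ≤ D
        bound = begin
          unitsIn b (map target T) T  ≡⟨ unitsIn-targets b T ⟩
          weight (indicator b) T      ≡⟨ perfect (indicator b) ⟩
          D * Σ< K (indicator b)      ≤⟨ *-monoʳ-≤ D (Σ<-indicator≤1 K b) ⟩
          D * 1                       ≡⟨ *-identityʳ D ⟩
          D                           ∎
          where open ≤-Reasoning

      minimal : ∀ k → Packable (toItems T) k → K ≤ k
      minimal k (a , len , a<k , loads) = *-cancelˡ-≤ D (begin
        D * K                         ≡⟨ cong (D *_) (≡.trans (sym (*-identityʳ K)) (sym (Σ<-const K 1))) ⟩
        D * Σ< K (λ _ → 1)            ≡⟨ perfect (λ _ → 1) ⟨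
        totalUnits T                  ≡⟨ Σ<-unitsIn k a T (≡.trans len (length-map toItem T)) a<k ⟨
        Σ< k (λ b → unitsIn b a T)    ≤⟨ Σ<-mono k (λ b → ÷-cancel-≤ D (ℚₚ.≤-trans
                                          (ℚₚ.≤-reflexive (sym (loadOf-÷ b a T)))
                                          (ℚₚ.≤-trans (loads b) (ℚₚ.≤-reflexive (sym (d÷d≡1 D)))))) ⟩
        Σ< k (λ _ → D)                ≡⟨ Σ<-const k D ⟩
        k * D                         ≡⟨ *-comm k D ⟩
        D * k                         ∎)
        where open ≤-Reasoning

-- Bounded Best-Fit when earlier bins are out of reach

module BoundedBestFit where
  open import Data.Bool using (Bool; true; false; if_then_else_; _∧_)
  open import Data.Bool.Properties using (T?; ∨-zeroʳ)
  open import Data.Nat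
  open import Data.Nat.Properties
  open import Data.Nat.ListAction using (sum)
  open import Data.Rational as ℚ using (ℚ; 0ℚ; 1ℚ)
  import Data.Rational.Properties as ℚₚ
  open import Data.List using (List; []; _∷_; _++_; map; length; filter; foldl)
  open import Data.List.Properties using (length-++; filter-all; foldl-++)
  open import Data.List.Relation.Unary.All as All using (All; []; _∷_)
  open import Data.List.Relation.Unary.All.Properties using (++⁺)
  open import Data.Maybe using (just; nothing)
  open import Data.Product using (Σ; _×_; _,_; proj₁; proj₂)
  open import Relation.Binary.PropositionalEquality
  open Fractions
  open Packings using (≡ᵇ-refl)

  -- The where-bound functions of Defs have no names here.  In a mutual block like this one unification
  -- finds such a function from one equation in which it occurs; the with-abstractions are there to
  -- make it occur applied to distinct variables.
  mutual
    searchLevel : ℕ → ℚ → ℕ → ℕ → ℕ → ℕ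
    searchLevel = _

    lowestLevel-unfold : ∀ j s from f → j ∸ from ≡ suc f →
      lowestLevel j s from ≡
        (if s ℚ.≤ᵇ regionSize j from then from else searchLevel j s from f (suc from))
    lowestLevel-unfold j s from f eq with j ∸ from
    lowestLevel-unfold j s from f refl | .(suc f) with suc from
    lowestLevel-unfold j s from f refl | .(suc f) | next = refl

  lowestLevel-fits : ∀ j s from → from < j → s ℚ.≤ regionSize j from → lowestLevel j s from ≡ from
  lowestLevel-fits j s from from<j s≤ with j ∸ from in eq
  ... | zero  = refl
  ... | suc f rewrite ≤ᵇ-true s≤ = refl

  regionSize<1 : ∀ j i → i < j → regionSize j i ℚ.< 1ℚ
  regionSize<1 j i i<j = subst₂ ℚ._<_ (sym (regionSize-scaled j i 1)) (d÷d≡1 (2 ^ j * 1))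
    (÷-mono-< (2 ^ j * 1) (*-monoˡ-< 1 (^-monoʳ-< 2 (s≤s (s≤s z≤n)) i<j)))
    where
    instance
      2^j*1≢0 : NonZero (2 ^ j * 1)
      2^j*1≢0 = m*n≢0 (2 ^ j) 1 {{m^n≢0 2 j}}

  -- Every level below `j` rejects an item of size 1, and when the fuel runs out the search returns
  -- its current level, by then `j`, without a test.
  searchLevel-full : ∀ j from f i → f + i ≡ j → searchLevel j 1ℚ from f i ≡ j
  searchLevel-full j from zero    i eq = eq
  searchLevel-full j from (suc f) i eq
    rewrite ≤ᵇ-false (regionSize<1 j i (≤-trans (s≤s (m≤n+m i f)) (≤-reflexive eq))) =
    searchLevel-full j from f (suc i) (trans (+-suc f i) eq)

  lowestLevel-full : ∀ j → 1 ≤ j → lowestLevel j 1ℚ 1 ≡ j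
  lowestLevel-full (suc zero)    1≤j = refl
  lowestLevel-full (suc (suc f)) 1≤j =
    searchLevel-full (suc (suc f)) 1 (suc f) 1 (+-comm (suc f) 1)

  -- Opaque, so that a run over the long explicit blocks below is advanced by these equations and
  -- not by unfolding `step` item after item.
  opaque
    process : Variant → ℕ → State → Instance → State
    process v j = foldl (step v j)

    process-def : ∀ v j st I → process v j st I ≡ foldl (step v j) st I
    process-def v j st I = refl

    Pc-∷ : ∀ v j e I c → Pc v j (e ∷ I) c ≡
      length (filter (λ b → T? (hasColour c b)) (process v j (step v j [] e) I))
    Pc-∷ v j e I c = refl

    process-∷ : ∀ v j st e I → process v j st (e ∷ I) ≡ process v j (step v j st e) I
    process-∷ v j st e I = refl

    process-[] : ∀ v j st → process v j st [] ≡ st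
    process-[] v j st = refl

    process-++ : ∀ v j st I J → process v j st (I ++ J) ≡ process v j (process v j st I) J
    process-++ v j = foldl-++ (step v j)

  module _ (D : ℕ) .{{D≢0 : NonZero D}} (v : Variant) (j : ℕ) (c : ℕ) where

    isolated : Bool → ℕ → Bin
    isolated o n = bin (iso o) (reg c (n ÷ D) ∷ [])

    -- The flag is arbitrary: the load alone keeps later items out, so it is irrelevant which bin
    -- gets closed, and when.
    data Loaded (τ : ℕ) : Bin → Set where
      loaded : ∀ o {n} → τ ≤ n → Loaded τ (isolated o n)

    weaken : ∀ {σ τ b} → σ ≤ τ → Loaded τ b → Loaded σ b
    weaken σ≤τ (loaded o τ≤n) = loaded o (≤-trans σ≤τ τ≤n)

    fitting : ℚ → List (ℕ × ℚ) → List (ℕ × ℚ)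
    fitting s = filter (λ p → T? ((proj₂ p ℚ.+ s) ℚ.≤ᵇ 1ℚ))

    opensFrom : ℕ → State → List (ℕ × ℚ)
    opensFrom m st = map (λ p → proj₁ p , binLoad (proj₂ p))
      (filter (λ p → T? (isIsoOpen (kind (proj₂ p)) ∧ hasColour c (proj₂ p))) (enumerate m st))

    binLoad+item : ∀ n x → (n ÷ D ℚ.+ 0ℚ) ℚ.+ x ÷ D ≡ (n + x) ÷ D
    binLoad+item n x = trans (cong (ℚ._+ x ÷ D) (ℚₚ.+-identityʳ (n ÷ D))) (÷-+ n x D)

    overfull : ∀ {n x} → D < n + x → ((n ÷ D ℚ.+ 0ℚ) ℚ.+ x ÷ D ℚ.≤ᵇ 1ℚ) ≡ false
    overfull {n} {x} D<n+x = ≤ᵇ-false (subst₂ ℚ._<_ (d÷d≡1 D) (sym (binLoad+item n x)) (÷-mono-< D D<n+x))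

    fits-bin : ∀ {n x} → n + x ≤ D → ((n ÷ D ℚ.+ 0ℚ) ℚ.+ x ÷ D ℚ.≤ᵇ 1ℚ) ≡ true
    fits-bin {n} {x} n+x≤D = ≤ᵇ-true (subst₂ ℚ._≤_ (sym (binLoad+item n x)) (d÷d≡1 D) (÷-mono-≤ D n+x≤D))

    none-fits : ∀ {τ x} m st → All (Loaded τ) st → D < τ + x → fitting (x ÷ D) (opensFrom m st) ≡ []
    none-fits m [] [] D<τ+x = refl
    none-fits m (_ ∷ st) (loaded false τ≤n ∷ ls) D<τ+x = none-fits (suc m) st ls D<τ+x
    none-fits {x = x} m (_ ∷ st) (loaded true {n} τ≤n ∷ ls) D<τ+x
      rewrite ≡ᵇ-refl c | overfull {n} {x} (<-≤-trans D<τ+x (+-monoˡ-≤ x τ≤n)) = none-fits (suc m) st ls D<τ+x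

    -- A single candidate remains, so `argmax` has nothing to compare and the best-fit rule is never
    -- put to the test.
    only-last-fits : ∀ {τ x y} m st → All (Loaded τ) st → D < τ + x → y + x ≤ D →
      fitting (x ÷ D) (opensFrom m (st ++ isolated true y ∷ [])) ≡ (m + length st , y ÷ D ℚ.+ 0ℚ) ∷ []
    only-last-fits {x = x} {y} m [] [] D<τ+x y+x≤D
      rewrite ≡ᵇ-refl c | fits-bin {y} {x} y+x≤D | +-identityʳ m = refl
    only-last-fits m (_ ∷ st) (loaded false τ≤n ∷ ls) D<τ+x y+x≤D
      rewrite +-suc m (length st) = only-last-fits (suc m) st ls D<τ+x y+x≤D
    only-last-fits {x = x} m (_ ∷ st) (loaded true {n} τ≤n ∷ ls) D<τ+x y+x≤D
      rewrite ≡ᵇ-refl c | overfull {n} {x} (<-≤-trans D<τ+x (+-monoˡ-≤ x τ≤n)) | +-suc m (length st) =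
      only-last-fits (suc m) st ls D<τ+x y+x≤D

    modifyAt-last : ∀ f st b → modifyAt (length st) f (st ++ b ∷ []) ≡ st ++ f b ∷ []
    modifyAt-last f []       b = refl
    modifyAt-last f (b′ ∷ st) b = cong (b′ ∷_) (modifyAt-last f st b)

    length-modifyAt : ∀ n f st → length (modifyAt n f st) ≡ length st
    length-modifyAt n       f []       = refl
    length-modifyAt zero    f (b ∷ st) = refl
    length-modifyAt (suc n) f (b ∷ st) = cong suc (length-modifyAt n f st)

    close-loaded : ∀ {τ} n st → All (Loaded τ) st → All (Loaded τ) (modifyAt n closeBin st)
    close-loaded n       []       []                = []
    close-loaded zero    (_ ∷ st) (loaded o l ∷ ls) = loaded false l ∷ ls
    close-loaded (suc n) (_ ∷ st) (l ∷ ls)          = l ∷ close-loaded n st ls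

    bbf-opens : ∀ {τ x} st → All (Loaded τ) st → D < τ + x →
      Σ State λ st′ → bbfStep c (x ÷ D) st ≡ st′ ++ isolated true x ∷ []
        × length st′ ≡ length st × All (Loaded τ) st′
    bbf-opens {τ} {x} st ls D<τ+x rewrite none-fits 0 st ls D<τ+x
      with 2 ≤ᵇ length (openBinsOf c st) | argmax (openBinsOf c st)
    ... | true  | just n  = _ , refl , length-modifyAt n closeBin st , close-loaded n st ls
    ... | true  | nothing = _ , refl , refl , ls
    ... | false | just n  = _ , refl , refl , ls
    ... | false | nothing = _ , refl , refl , ls

    bbf-fills : ∀ {τ x y} st → All (Loaded τ) st → D < τ + x → y + x ≤ D →
      bbfStep c (x ÷ D) (st ++ isolated true y ∷ []) ≡ st ++ isolated true (y + x) ∷ []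
    bbf-fills {τ} {x} {y} st ls D<τ+x y+x≤D rewrite only-last-fits 0 st ls D<τ+x y+x≤D =
      trans (modifyAt-last (addToBin c (x ÷ D)) st (isolated true y))
        (cong (λ q → st ++ bin (iso true) (reg c q ∷ []) ∷ []) (÷-+ y x D))

    inBBF-snoc : ∀ st o n → inBBF c (st ++ isolated o n ∷ []) ≡ true
    inBBF-snoc []       o n rewrite ≡ᵇ-refl c = refl
    inBBF-snoc (b ∷ st) o n rewrite inBBF-snoc st o n = ∨-zeroʳ _

    inBBF-loaded : ∀ {τ b} st → Loaded τ b → inBBF c (b ∷ st) ≡ true
    inBBF-loaded st (loaded o _) rewrite ≡ᵇ-refl c = refl

    unit : ℕ → Item
    unit x = item (x ÷ D) c

    step-bbf : ∀ st x → inBBF c st ≡ true → step v j st (unit x) ≡ bbfStep c (x ÷ D) st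
    step-bbf st x eq rewrite eq = refl

    fill : ∀ {τ} st y xs → All (Loaded τ) st → All (λ x → D < τ + x) xs → y + sum xs ≤ D →
      foldl (step v j) (st ++ isolated true y ∷ []) (map unit xs) ≡ st ++ isolated true (y + sum xs) ∷ []
    fill st y []       ls []           y≤D = cong (λ n → st ++ isolated true n ∷ []) (sym (+-identityʳ y))
    fill st y (x ∷ xs) ls (big ∷ bigs) y≤D = begin
      foldl (step v j) (step v j (st ++ isolated true y ∷ []) (unit x)) (map unit xs)
        ≡⟨ cong (λ s → foldl (step v j) s (map unit xs))
             (trans (step-bbf (st ++ isolated true y ∷ []) x (inBBF-snoc st true y))
               (bbf-fills st ls big (≤-trans (m≤m+n (y + x) (sum xs)) y+x+Σ≤D))) ⟩
      foldl (step v j) (st ++ isolated true (y + x) ∷ []) (map unit xs)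
        ≡⟨ fill st (y + x) xs ls bigs y+x+Σ≤D ⟩
      st ++ isolated true (y + x + sum xs) ∷ []
        ≡⟨ cong (λ n → st ++ isolated true n ∷ []) (+-assoc y x (sum xs)) ⟩
      st ++ isolated true (y + sum (x ∷ xs)) ∷ []
        ∎
      where
      open ≡-Reasoning
      y+x+Σ≤D : y + x + sum xs ≤ D
      y+x+Σ≤D = ≤-trans (≤-reflexive (+-assoc y x (sum xs))) y≤D

    -- `k` leaves out the bin of the initial item of size 1. That bin makes the state nonempty,
    -- which is what ensures that the colour is served by Best-Fit.
    record Served (τ k : ℕ) (st : State) : Set where
      constructor served
      field
        count : length st ≡ suc k
        loads : All (Loaded τ) st

    -- The bin being filled stays outside the threshold invariant and joins it only with its final
    -- load. Hence each item of the chunk must overflow the old threshold `τ`, and the new one `σ`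
    -- may be lower.
    run-chunk : ∀ {τ k st} σ x xs → Served τ k st → All (λ y → D < τ + y) (x ∷ xs) →
      x + sum xs ≤ D → σ ≤ τ → σ ≤ x + sum xs →
      Served σ (suc k) (foldl (step v j) st (map unit (x ∷ xs)))
    run-chunk {st = st@(_ ∷ tl)} σ x xs (served len (l ∷ ls)) (big ∷ bigs) sum≤D σ≤τ σ≤sum
      with bbf-opens st (l ∷ ls) big
    ... | st′ , eq , len′ , ls′
      rewrite step-bbf st x (inBBF-loaded tl l) | eq | fill st′ x xs ls′ bigs sum≤D =
      served
        (trans (length-++ st′) (trans (+-comm (length st′) 1) (cong suc (trans len′ len))))
        (++⁺ (All.map (weaken σ≤τ) ls′) (loaded true σ≤sum ∷ []))

    -- Stated about the final state end, since serving a chunk leaves it unchanged and only shortens I.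
    Reaches : ℕ → ℕ → State → Instance → Set
    Reaches τ k end I = Σ State λ st → process v j st I ≡ end × Served τ k st

    serve-chunk : ∀ {τ k end} σ x xs I → Reaches τ k end (map unit (x ∷ xs) ++ I) →
      All (λ y → D < τ + y) (x ∷ xs) → x + sum xs ≤ D → σ ≤ τ → σ ≤ x + sum xs →
      Reaches σ (suc k) end I
    serve-chunk σ x xs I (st , eq , inv) bigs sum≤D σ≤τ σ≤sum =
      process v j st (map unit (x ∷ xs)) ,
      trans (sym (process-++ v j st (map unit (x ∷ xs)) I)) eq ,
      subst (Served σ _) (sym (process-def v j st (map unit (x ∷ xs)))) (run-chunk σ x xs inv bigs sum≤D σ≤τ σ≤sum)

    Reaches-weaken : ∀ {σ τ k end I} → σ ≤ τ → Reaches τ k end I → Reaches σ k end I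
    Reaches-weaken σ≤τ (st , eq , served len ls) = st , eq , served len (All.map (weaken σ≤τ) ls)

    -- Only a level-j region holds an item of size 1, so the colour owns an isolated bin from the
    -- start. That bin is full, which provides the strongest possible threshold.
    serve-first : 1 ≤ j → Served D 0 (step v j [] (unit D))
    serve-first 1≤j rewrite d÷d≡1 D {{D≢0}} | lowestLevel-full j 1≤j | ≡ᵇ-refl j =
      served refl (subst (λ q → Loaded D (bin (iso true) (reg c q ∷ []))) (d÷d≡1 D) (loaded true ≤-refl) ∷ [])

    Served-Pc : ∀ {τ k st} → Served τ k st → length (filter (λ b → T? (hasColour c b)) st) ≡ suc k
    Served-Pc (served len ls) = trans (cong length (filter-all (λ b → T? (hasColour c b)) (All.map coloured ls))) len
      where
      import Data.Bool
      coloured : ∀ {τ b} → Loaded τ b → Data.Bool.T (hasColour c b)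
      coloured (loaded o _) rewrite ≡ᵇ-refl c = _

-- The instance for the factor 1.7

module BestFitInstance where
  open import Data.Bool using (T)
  open import Data.Nat
  open import Data.Nat.Properties
  open import Data.List using (List; []; _∷_)
  open import Data.List.Relation.Unary.All using (All; []; _∷_)
  open import Data.Product using (_×_; _,_)
  open import Function using (_∘_)
  open import Relation.Binary.PropositionalEquality
  open import Data.Nat.Tactic.RingSolver using (solve-∀)
  open Packings

  -- In units of 1 / (6 q) with q = p + 600 s, and with d = 40 s the scale of the block, row i consists of
  -- the items q + X i * d, 2 q + Y i * d and 3 q - (X i + Y i) * d, where
  --   X = 28, -6, -6, -11, 8, -2, -2, -2, -2, -1   and   Y = -29, 5, 5, 10, -9, 1, 1, 1, 1, 39 / 40.
  -- The last Y is 39 at the scale s of the next block, whose first medium bin that item opens.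
  -- The small items of rows 4 and 5 arrive in reverse order, which puts them into the right fives.
  smallBlock mediumBlock largeBlock : ℕ → ℕ → ℕ → List Job → List Job
  smallBlock k p s R =
    job k 0 (p + 1720 * s) ∷
    job (1 + k) 0 (p + 360 * s) ∷
    job (2 + k) 0 (p + 360 * s) ∷
    job (3 + k) 0 (p + 160 * s) ∷
    job (5 + k) 0 (p + 520 * s) ∷
    job (4 + k) 0 (p + 920 * s) ∷
    job (6 + k) 0 (p + 520 * s) ∷
    job (7 + k) 0 (p + 520 * s) ∷
    job (8 + k) 0 (p + 520 * s) ∷
    job (9 + k) 0 (p + 560 * s) ∷ R
  mediumBlock k p s R =
    job k 0 (2 * p + 40 * s) ∷
    job (1 + k) 0 (2 * p + 1400 * s) ∷
    job (2 + k) 0 (2 * p + 1400 * s) ∷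
    job (3 + k) 0 (2 * p + 1600 * s) ∷
    job (4 + k) 0 (2 * p + 840 * s) ∷
    job (5 + k) 0 (2 * p + 1240 * s) ∷
    job (6 + k) 0 (2 * p + 1240 * s) ∷
    job (7 + k) 0 (2 * p + 1240 * s) ∷
    job (8 + k) 0 (2 * p + 1240 * s) ∷
    job (9 + k) 0 (2 * p + 1239 * s) ∷ R
  largeBlock k p s R =
    job k 0 (3 * p + 1840 * s) ∷
    job (1 + k) 0 (3 * p + 1840 * s) ∷
    job (2 + k) 0 (3 * p + 1840 * s) ∷
    job (3 + k) 0 (3 * p + 1840 * s) ∷
    job (4 + k) 0 (3 * p + 1840 * s) ∷
    job (5 + k) 0 (3 * p + 1840 * s) ∷
    job (6 + k) 0 (3 * p + 1840 * s) ∷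
    job (7 + k) 0 (3 * p + 1840 * s) ∷
    job (8 + k) 0 (3 * p + 1840 * s) ∷
    job (9 + k) 0 (3 * p + 1801 * s) ∷ R

  -- Bins 0 and 1 are reserved for the item of size 1 and the two halves.
  firstBin : ℕ → ℕ
  firstBin n = 2 + n * 10

  -- Taking 600 s from each q avoids negative perturbations: the lowest are -440 s for a small item,
  -- which contains one q, and -1160 s for a medium item, which contains two.
  offset : ℕ → ℕ → ℕ
  offset q n = q ∸ 600 * 40 ^ n

  smalls mediums larges : ℕ → ℕ → List Job → List Job
  smalls  q zero    R = R
  smalls  q (suc n) R = smallBlock (firstBin n) (offset q n) (40 ^ n) (smalls q n R)
  mediums q zero    R = R
  mediums q (suc n) R = mediumBlock (firstBin n) (offset q n) (40 ^ n) (mediums q n R)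
  larges  q zero    R = R
  larges  q (suc n) R = largeBlock (firstBin n) (offset q n) (40 ^ n) (larges q n R)

  half : ℕ → Job
  half q = job 1 0 (3 * q)

  -- The first half opens the first medium pair, in place of the item that a previous block would
  -- hand over; the second half is the partner of the medium item that the last block leaves behind.
  -- Together they fill bin 1.
  jobs : ℕ → ℕ → List Job
  jobs q n = job 0 0 (6 * q) ∷ smalls q n (half q ∷ mediums q n (half q ∷ larges q n []))

  offset-≡ : ∀ q n → 2000 * 40 ^ n ≤ q → q ≡ offset q n + 600 * 40 ^ n
  offset-≡ q n bound = sym (m∸n+n≡m (≤-trans (*-monoˡ-≤ (40 ^ n) (≤ᵇ⇒≤ 600 2000 _)) bound))

  bound-pred : ∀ {q} n → 2000 * 40 ^ suc n ≤ q → 2000 * 40 ^ n ≤ q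
  bound-pred n bound = ≤-trans (*-monoʳ-≤ 2000 (m≤m+n (40 ^ n) (39 * 40 ^ n))) bound

  gap : ∀ {a b} k → a + k ≡ b → a ≤ b
  gap {a} k eq = ≤-trans (m≤m+n a k) (≤-reflexive eq)

  -- In each row the perturbations X, Y and -(X + Y) cancel, so every bin of the block receives
  -- exactly 6 q.
  weight-block : ∀ w k p s A B C →
    weight w (smallBlock k p s A) + weight w (mediumBlock k p s B) + weight w (largeBlock k p s C) ≡
    weight w A + weight w B + weight w C + 6 * (p + 600 * s) *
      (w k + w (1 + k) + w (2 + k) + w (3 + k) + w (4 + k) + w (5 + k) + w (6 + k) + w (7 + k) + w (8 + k) + w (9 + k))
  weight-block w k p s A B C = sums p s (weight w A) (weight w B) (weight w C)
    (w k) (w (1 + k)) (w (2 + k)) (w (3 + k)) (w (4 + k)) (w (5 + k)) (w (6 + k)) (w (7 + k)) (w (8 + k)) (w (9 + k))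
    where
    sums : ∀ p s a b c w0 w1 w2 w3 w4 w5 w6 w7 w8 w9 →
      (w0 * (p + 1720 * s) + (w1 * (p + 360 * s) + (w2 * (p + 360 * s) + (w3 * (p + 160 * s) +
       (w5 * (p + 520 * s) + (w4 * (p + 920 * s) + (w6 * (p + 520 * s) + (w7 * (p + 520 * s) +
       (w8 * (p + 520 * s) + (w9 * (p + 560 * s) + a)))))))))) +
      (w0 * (2 * p + 40 * s) + (w1 * (2 * p + 1400 * s) + (w2 * (2 * p + 1400 * s) + (w3 * (2 * p + 1600 * s) +
       (w4 * (2 * p + 840 * s) + (w5 * (2 * p + 1240 * s) + (w6 * (2 * p + 1240 * s) + (w7 * (2 * p + 1240 * s) +
       (w8 * (2 * p + 1240 * s) + (w9 * (2 * p + 1239 * s) + b)))))))))) +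
      (w0 * (3 * p + 1840 * s) + (w1 * (3 * p + 1840 * s) + (w2 * (3 * p + 1840 * s) + (w3 * (3 * p + 1840 * s) +
       (w4 * (3 * p + 1840 * s) + (w5 * (3 * p + 1840 * s) + (w6 * (3 * p + 1840 * s) + (w7 * (3 * p + 1840 * s) +
       (w8 * (3 * p + 1840 * s) + (w9 * (3 * p + 1801 * s) + c)))))))))) ≡
      a + b + c + 6 * (p + 600 * s) * (w0 + w1 + w2 + w3 + w4 + w5 + w6 + w7 + w8 + w9)
    sums = solve-∀

  -- The term `6 * q * (w 0 + w 1)` is the full load of bins 0 and 1, which no block touches; it
  -- completes the sum on the right and makes the case of no blocks trivial.
  weight-blocks : ∀ w q n A B C → 2000 * 40 ^ n ≤ q →
    weight w (smalls q n A) + weight w (mediums q n B) + weight w (larges q n C) + 6 * q * (w 0 + w 1) ≡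
    weight w A + weight w B + weight w C + 6 * q * Σ< (firstBin n) w
  weight-blocks w q zero    A B C bound = refl
  weight-blocks w q (suc n) A B C bound = begin
    weight w (smalls q (suc n) A) + weight w (mediums q (suc n) B) + weight w (larges q (suc n) C) + 6 * q * (w 0 + w 1)
      ≡⟨ cong (_+ 6 * q * (w 0 + w 1)) (weight-block w k (offset q n) (40 ^ n) (smalls q n A) (mediums q n B) (larges q n C)) ⟩
    rest + 6 * (offset q n + 600 * 40 ^ n) * new + 6 * q * (w 0 + w 1)
      ≡⟨ cong (λ x → rest + 6 * x * new + 6 * q * (w 0 + w 1)) (sym (offset-≡ q n (bound-pred n bound))) ⟩
    rest + 6 * q * new + 6 * q * (w 0 + w 1)
      ≡⟨ shuffle rest (6 * q * new) (6 * q * (w 0 + w 1)) ⟩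
    rest + 6 * q * (w 0 + w 1) + 6 * q * new
      ≡⟨ cong (_+ 6 * q * new) (weight-blocks w q n A B C (bound-pred n bound)) ⟩
    weight w A + weight w B + weight w C + 6 * q * Σ< k w + 6 * q * new
      ≡⟨ collect (weight w A + weight w B + weight w C) (6 * q) (Σ< k w)
           (w k) (w (1 + k)) (w (2 + k)) (w (3 + k)) (w (4 + k)) (w (5 + k)) (w (6 + k)) (w (7 + k)) (w (8 + k)) (w (9 + k)) ⟩
    weight w A + weight w B + weight w C + 6 * q * Σ< (firstBin (suc n)) w
      ∎
    where
    open ≡-Reasoning
    k = firstBin n
    rest = weight w (smalls q n A) + weight w (mediums q n B) + weight w (larges q n C)
    new = w k + w (1 + k) + w (2 + k) + w (3 + k) + w (4 + k) + w (5 + k) + w (6 + k) + w (7 + k) + w (8 + k) + w (9 + k)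
    shuffle : ∀ a b c → a + b + c ≡ a + c + b
    shuffle = solve-∀
    collect : ∀ a d S w0 w1 w2 w3 w4 w5 w6 w7 w8 w9 →
      a + d * S + d * (w0 + w1 + w2 + w3 + w4 + w5 + w6 + w7 + w8 + w9) ≡
      a + d * (S + w0 + w1 + w2 + w3 + w4 + w5 + w6 + w7 + w8 + w9)
    collect = solve-∀

  jobs-perfect : ∀ q n .{{_ : NonZero (6 * q)}} → 2000 * 40 ^ n ≤ q → PerfectPacking (6 * q) (firstBin n) (jobs q n)
  -- The three lists are nested, so each tail passed to `weight-blocks` contains the next list
  -- again. What is thereby counted on both sides is cancelled.
  jobs-perfect q n bound w = +-cancelʳ-≡ (m + l + 6 * q * w 1) _ _ (begin
    w 0 * (6 * q) + sm + (m + l + 6 * q * w 1)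
      ≡⟨ regroup (w 0) (w 1) q sm m l ⟩
    sm + m + l + 6 * q * (w 0 + w 1)
      ≡⟨ weight-blocks w q n (half q ∷ mediums q n (half q ∷ larges q n [])) (half q ∷ larges q n []) [] bound ⟩
    w 1 * (3 * q) + m + (w 1 * (3 * q) + l) + 0 + 6 * q * Σ< (firstBin n) w
      ≡⟨ regroup′ (w 1) q m l (6 * q * Σ< (firstBin n) w) ⟩
    6 * q * Σ< (firstBin n) w + (m + l + 6 * q * w 1)
      ∎)
    where
    open ≡-Reasoning
    l = weight w (larges q n [])
    m = weight w (mediums q n (half q ∷ larges q n []))
    sm = weight w (smalls q n (half q ∷ mediums q n (half q ∷ larges q n [])))
    regroup : ∀ w0 w1 q a b c → w0 * (6 * q) + a + (b + c + 6 * q * w1) ≡ a + b + c + 6 * q * (w0 + w1)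
    regroup = solve-∀
    regroup′ : ∀ w1 q b c S → w1 * (3 * q) + b + (w1 * (3 * q) + c) + 0 + S ≡ S + (b + c + 6 * q * w1)
    regroup′ = solve-∀

  -- In units of 1 / (6 q) the lower bound says that the size is at least 1/8, which is ε for j = 3.
  InRange : ℕ → ℕ → Set
  InRange q x = 3 * q ≤ 4 * x × x ≤ 6 * q

  small-range : ∀ a {p s} → {T (160 ≤ᵇ a)} → {T (a ≤ᵇ 3600)} → 1400 * s ≤ p → InRange (p + 600 * s) (p + a * s)
  small-range a {p} {s} {lo} {hi} 1400s≤p =
    ≤-trans (≤-reflexive (lhs p s)) (≤-trans (+-monoʳ-≤ (3 * p) (+-mono-≤ (≤-trans (*-monoˡ-≤ s (≤ᵇ⇒≤ 1160 1400 _)) 1400s≤p)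
      (*-monoˡ-≤ s (*-monoʳ-≤ 4 (≤ᵇ⇒≤ 160 a lo))))) (≤-reflexive (rhs p s a))) ,
    ≤-trans (+-mono-≤ (m≤m+n p (5 * p)) (*-monoˡ-≤ s (≤ᵇ⇒≤ a 3600 hi))) (≤-reflexive (top p s))
    where
    lhs : ∀ p s → 3 * (p + 600 * s) ≡ 3 * p + (1160 * s + 4 * 160 * s)
    lhs = solve-∀
    rhs : ∀ p s a → 3 * p + (p + 4 * a * s) ≡ 4 * (p + a * s)
    rhs = solve-∀
    top : ∀ p s → (p + 5 * p) + 3600 * s ≡ 6 * (p + 600 * s)
    top = solve-∀

  wide-range : ∀ c a {p s} → {T (2 ≤ᵇ c)} → {T (c ≤ᵇ 6)} → {T (a ≤ᵇ 3600)} → 1400 * s ≤ p →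
    InRange (p + 600 * s) (c * p + a * s)
  wide-range c a {p} {s} {lo} {hi} {hi′} 1400s≤p =
    ≤-trans (≤-trans (≤-reflexive (lhs p s)) (≤-trans (+-monoʳ-≤ (3 * p)
        (≤-trans (≤-trans (*-monoˡ-≤ s (≤ᵇ⇒≤ 1800 (5 * 1400) _)) (≤-trans (≤-reflexive (*-assoc 5 1400 s)) (*-monoʳ-≤ 5 1400s≤p)))
          (m≤m+n (5 * p) (4 * (a * s)))))
      (≤-reflexive (rhs p (a * s))))) (*-monoʳ-≤ 4 (+-monoˡ-≤ (a * s) (*-monoˡ-≤ p (≤ᵇ⇒≤ 2 c lo)))) ,
    ≤-trans (+-mono-≤ (*-monoˡ-≤ p (≤ᵇ⇒≤ c 6 hi)) (*-monoˡ-≤ s (≤ᵇ⇒≤ a 3600 hi′))) (≤-reflexive (top p s))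
    where
    lhs : ∀ p s → 3 * (p + 600 * s) ≡ 3 * p + 1800 * s
    lhs = solve-∀
    rhs : ∀ p x → 3 * p + (5 * p + 4 * x) ≡ 4 * (2 * p + x)
    rhs = solve-∀
    top : ∀ p s → 6 * p + 3600 * s ≡ 6 * (p + 600 * s)
    top = solve-∀

  -- 2000 is 600 for the shift plus the 1400 that the size estimates draw upon; the tightest of
  -- them, for the small item with perturbation -440 s, takes 1160.
  offset-≥ : ∀ q n → 2000 * 40 ^ n ≤ q → 1400 * 40 ^ n ≤ offset q n
  offset-≥ q n bound = m+n≤o⇒m≤o∸n (1400 * 40 ^ n) (≤-trans (≤-reflexive (sym (*-distribʳ-+ (40 ^ n) 1400 600))) bound)

  module _ {q : ℕ} (p s : ℕ) (eq : q ≡ p + 600 * s) (1400s≤p : 1400 * s ≤ p) (k : ℕ) {R : List Job} (rs : All (InRange q ∘ units) R) where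

    small : ∀ a {lo : T (160 ≤ᵇ a)} {hi : T (a ≤ᵇ 3600)} → InRange q (p + a * s)
    small a {lo} {hi} = subst (λ q → InRange q (p + a * s)) (sym eq) (small-range a {p} {s} {lo} {hi} 1400s≤p)

    wide : ∀ c a {lo : T (2 ≤ᵇ c)} {hi : T (c ≤ᵇ 6)} {hi′ : T (a ≤ᵇ 3600)} → InRange q (c * p + a * s)
    wide c a {lo} {hi} {hi′} = subst (λ q → InRange q (c * p + a * s)) (sym eq) (wide-range c a {p} {s} {lo} {hi} {hi′} 1400s≤p)

    smallBlock-range : All (InRange q ∘ units) (smallBlock k p s R)
    smallBlock-range = small 1720 ∷ small 360 ∷ small 360 ∷ small 160 ∷ small 520 ∷
      small 920 ∷ small 520 ∷ small 520 ∷ small 520 ∷ small 560 ∷ rs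

    mediumBlock-range : All (InRange q ∘ units) (mediumBlock k p s R)
    mediumBlock-range = wide 2 40 ∷ wide 2 1400 ∷ wide 2 1400 ∷ wide 2 1600 ∷ wide 2 840 ∷
      wide 2 1240 ∷ wide 2 1240 ∷ wide 2 1240 ∷ wide 2 1240 ∷ wide 2 1239 ∷ rs

    largeBlock-range : All (InRange q ∘ units) (largeBlock k p s R)
    largeBlock-range = wide 3 1840 ∷ wide 3 1840 ∷ wide 3 1840 ∷ wide 3 1840 ∷ wide 3 1840 ∷
      wide 3 1840 ∷ wide 3 1840 ∷ wide 3 1840 ∷ wide 3 1840 ∷ wide 3 1801 ∷ rs

  smalls-range : ∀ q n {R} → 2000 * 40 ^ n ≤ q → All (InRange q ∘ units) R → All (InRange q ∘ units) (smalls q n R)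
  smalls-range q zero    bound rs = rs
  smalls-range q (suc n) bound rs = smallBlock-range (offset q n) (40 ^ n) (offset-≡ q n b) (offset-≥ q n b) (firstBin n) (smalls-range q n b rs)
    where b = bound-pred n bound

  mediums-range : ∀ q n {R} → 2000 * 40 ^ n ≤ q → All (InRange q ∘ units) R → All (InRange q ∘ units) (mediums q n R)
  mediums-range q zero    bound rs = rs
  mediums-range q (suc n) bound rs = mediumBlock-range (offset q n) (40 ^ n) (offset-≡ q n b) (offset-≥ q n b) (firstBin n) (mediums-range q n b rs)
    where b = bound-pred n bound

  larges-range : ∀ q n {R} → 2000 * 40 ^ n ≤ q → All (InRange q ∘ units) R → All (InRange q ∘ units) (larges q n R)
  larges-range q zero    bound rs = rs
  larges-range q (suc n) bound rs = largeBlock-range (offset q n) (40 ^ n) (offset-≡ q n b) (offset-≥ q n b) (firstBin n) (larges-range q n b rs)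
    where b = bound-pred n bound

  jobs-range : ∀ q n → 2000 * 40 ^ n ≤ q → All (InRange q ∘ units) (jobs q n)
  jobs-range q n bound = (≤-trans (*-monoˡ-≤ q (≤ᵇ⇒≤ 3 24 _)) (≤-reflexive (*-assoc 4 6 q)) , ≤-refl) ∷
    smalls-range q n bound (h ∷ mediums-range q n bound (h ∷ larges-range q n bound []))
    where
    h : InRange q (3 * q)
    h = m≤m+n (3 * q) (3 * (3 * q)) , *-monoˡ-≤ q (≤ᵇ⇒≤ 3 6 _)

  Mono : Job → Set
  Mono t = jcolour t ≡ 0

  smalls-colour : ∀ q n {R} → All Mono R → All Mono (smalls q n R)
  smalls-colour q zero    ms = ms
  smalls-colour q (suc n) ms = refl ∷ refl ∷ refl ∷ refl ∷ refl ∷ refl ∷ refl ∷ refl ∷ refl ∷ refl ∷ smalls-colour q n ms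

  mediums-colour : ∀ q n {R} → All Mono R → All Mono (mediums q n R)
  mediums-colour q zero    ms = ms
  mediums-colour q (suc n) ms = refl ∷ refl ∷ refl ∷ refl ∷ refl ∷ refl ∷ refl ∷ refl ∷ refl ∷ refl ∷ mediums-colour q n ms

  larges-colour : ∀ q n {R} → All Mono R → All Mono (larges q n R)
  larges-colour q zero    ms = ms
  larges-colour q (suc n) ms = refl ∷ refl ∷ refl ∷ refl ∷ refl ∷ refl ∷ refl ∷ refl ∷ refl ∷ refl ∷ larges-colour q n ms

  jobs-colour : ∀ q n → All Mono (jobs q n)
  jobs-colour q n = refl ∷ smalls-colour q n (refl ∷ mediums-colour q n (refl ∷ larges-colour q n []))

-- Bounded Best-Fit on the 1.7 instance

module BestFitRun where
  open import Data.Bool using (T)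
  open import Data.Bool.Properties using (T?)
  open import Data.Nat
  open import Data.Nat.Properties
  import Data.Rational as ℚ
  import Data.Rational.Properties as ℚₚ
  open import Data.List using (List; []; _∷_; map; filter; length)
  open import Data.List.Properties using (filter-all)
  open import Data.List.Relation.Unary.All as All using (All; []; _∷_)
  open import Data.List.Relation.Unary.All.Properties using (map⁺)
  open import Data.Product using (Σ; _×_; _,_; proj₁; proj₂)
  open import Data.Unit using (tt)
  open import Function using (_∘_)
  open import Relation.Binary.PropositionalEquality
  open import Data.Nat.Tactic.RingSolver using (solve-∀)
  open Fractions
  open Packings
  open BoundedBestFit
  open BestFitInstance

  -- The item is q - (600 - a) s, so it overflows once the excess A over five sixths beats its
  -- deficit 600 - a. Only a comparison of literals remains, settled by evaluation.
  small-overflows : ∀ A a p s .{{_ : NonZero s}} → {T (600 <ᵇ A + a)} →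
    6 * (p + 600 * s) < 5 * (p + 600 * s) + A * s + (p + a * s)
  small-overflows A a p s {lt} = begin-strict
    6 * (p + 600 * s)                          ≡⟨ lhs p s ⟩
    (6 * p + 3000 * s) + 600 * s               <⟨ +-monoʳ-< (6 * p + 3000 * s) (*-monoˡ-< s (<ᵇ⇒< 600 (A + a) lt)) ⟩
    (6 * p + 3000 * s) + (A + a) * s           ≡⟨ rhs A a p s ⟩
    5 * (p + 600 * s) + A * s + (p + a * s)    ∎
    where
    open ≤-Reasoning
    lhs : ∀ p s → 6 * (p + 600 * s) ≡ (6 * p + 3000 * s) + 600 * s
    lhs = solve-∀
    rhs : ∀ A a p s → (6 * p + 3000 * s) + (A + a) * s ≡ 5 * (p + 600 * s) + A * s + (p + a * s)
    rhs = solve-∀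

  medium-overflows : ∀ A a p s .{{_ : NonZero s}} → {T (1200 <ᵇ A + a)} →
    6 * (p + 600 * s) < 4 * (p + 600 * s) + A * s + (2 * p + a * s)
  medium-overflows A a p s {lt} = begin-strict
    6 * (p + 600 * s)                              ≡⟨ lhs p s ⟩
    (6 * p + 2400 * s) + 1200 * s                  <⟨ +-monoʳ-< (6 * p + 2400 * s) (*-monoˡ-< s (<ᵇ⇒< 1200 (A + a) lt)) ⟩
    (6 * p + 2400 * s) + (A + a) * s               ≡⟨ rhs A a p s ⟩
    4 * (p + 600 * s) + A * s + (2 * p + a * s)    ∎
    where
    open ≤-Reasoning
    lhs : ∀ p s → 6 * (p + 600 * s) ≡ (6 * p + 2400 * s) + 1200 * s
    lhs = solve-∀
    rhs : ∀ A a p s → (6 * p + 2400 * s) + (A + a) * s ≡ 4 * (p + 600 * s) + A * s + (2 * p + a * s)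
    rhs = solve-∀

  below-scale : ∀ a b s r → {T (a ≤ᵇ b)} → r + a * s ≤ r + b * s
  below-scale a b s r {le} = +-monoʳ-≤ r (*-monoˡ-≤ s (≤ᵇ⇒≤ a b le))

  module _ (q : ℕ) .{{_ : NonZero (6 * q)}} (v : Variant) (j : ℕ) (end : State) where

    -- A record, because `Reaches` unfolds to a Σ type from which unification could not recover the
    -- list of jobs.
    record Filled (τ k : ℕ) (R : List Job) : Set where
      constructor filled
      field
        reaches : Reaches (6 * q) v j 0 τ k end (toItems (6 * q) R)
    open Filled public

    Filled-weaken : ∀ {σ τ k} R → σ ≤ τ → Filled τ k R → Filled σ k R
    Filled-weaken R σ≤τ (filled r) = filled (Reaches-weaken (6 * q) v j 0 σ≤τ r)

    chunk₁ : ∀ {τ k} σ t x R → Filled τ k (job t 0 x ∷ R) → 6 * q < τ + x → x ≤ 6 * q →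
      σ ≤ τ → σ ≤ x → Filled σ (suc k) R
    chunk₁ σ t x R (filled inv) big x≤ σ≤τ σ≤x = filled (serve-chunk (6 * q) v j 0 σ x [] (toItems (6 * q) R) inv (big ∷ [])
      (≤-trans (≤-reflexive (+-identityʳ x)) x≤) σ≤τ (≤-trans σ≤x (≤-reflexive (sym (+-identityʳ x)))))

    chunk₂ : ∀ {τ k} σ t t′ x x′ R → Filled τ k (job t 0 x ∷ job t′ 0 x′ ∷ R) →
      6 * q < τ + x → 6 * q < τ + x′ → x + x′ ≤ 6 * q → σ ≤ τ → σ ≤ x + x′ → Filled σ (suc k) R
    chunk₂ σ t t′ x x′ R (filled inv) big big′ sum≤ σ≤τ σ≤sum = filled (serve-chunk (6 * q) v j 0 σ x (x′ ∷ []) (toItems (6 * q) R) inv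
      (big ∷ big′ ∷ []) (≤-trans (+-monoʳ-≤ x (≤-reflexive (+-identityʳ x′))) sum≤) σ≤τ
      (≤-trans σ≤sum (+-monoʳ-≤ x (≤-reflexive (sym (+-identityʳ x′))))))

    -- The largest deficit, 440 s in row 3, is covered by the incoming excess 480 s. In the second
    -- five no deficit is above 80 s, so the excess 120 s of the first five is enough, and 40 s is
    -- left.
    smallBlock-run : ∀ {k} b p s R .{{_ : NonZero s}} → q ≡ p + 600 * s →
      Filled (5 * q + 480 * s) k (smallBlock b p s R) → Filled (5 * q + 40 * s) (2 + k) R
    smallBlock-run b p s R refl (filled inv) = filled (
      serve-chunk _ v j 0 (5q + 40 * s) (p + 920 * s) (p + 520 * s ∷ p + 520 * s ∷ p + 520 * s ∷ p + 560 * s ∷ []) (toItems _ R)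
        (serve-chunk _ v j 0 (5q + 120 * s) (p + 1720 * s) (p + 360 * s ∷ p + 360 * s ∷ p + 160 * s ∷ p + 520 * s ∷ []) _ inv
          (small-overflows 480 1720 p s ∷ small-overflows 480 360 p s ∷ small-overflows 480 360 p s ∷
           small-overflows 480 160 p s ∷ small-overflows 480 520 p s ∷ [])
          (≤-trans (≤-reflexive (sum₁ p s)) (upper 120))
          (below-scale 120 480 s 5q) (≤-reflexive (sym (sum₁ p s))))
        (small-overflows 120 920 p s ∷ small-overflows 120 520 p s ∷ small-overflows 120 520 p s ∷
         small-overflows 120 520 p s ∷ small-overflows 120 560 p s ∷ [])
        (≤-trans (≤-reflexive (sum₂ p s)) (upper 40))
        (below-scale 40 120 s 5q) (≤-reflexive (sym (sum₂ p s))))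
      where
      5q = 5 * (p + 600 * s)
      sum₁ : ∀ p s → p + 1720 * s + (p + 360 * s + (p + 360 * s + (p + 160 * s + (p + 520 * s + 0)))) ≡ 5 * (p + 600 * s) + 120 * s
      sum₁ = solve-∀
      sum₂ : ∀ p s → p + 920 * s + (p + 520 * s + (p + 520 * s + (p + 520 * s + (p + 560 * s + 0)))) ≡ 5 * (p + 600 * s) + 40 * s
      sum₂ = solve-∀
      upper : ∀ a → {T (a ≤ᵇ 600)} → 5q + a * s ≤ 6 * (p + 600 * s)
      upper a {le} = ≤-trans (below-scale a 600 s 5q {le}) (gap p (split p s))
        where
        split : ∀ p s → 5 * (p + 600 * s) + 600 * s + p ≡ 6 * (p + 600 * s)
        split = solve-∀

    -- Here the ratio 40 of the scales enters: a block leaves an excess of 40 s, and the next one,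
    -- at scale s / 40, asks for 480 s / 40 = 12 s.
    smalls-run : ∀ n {k} R → 2000 * 40 ^ n ≤ q → Filled (5 * q + 12 * 40 ^ n) k (smalls q n R) →
      Filled (5 * q) (n * 2 + k) R
    smalls-run zero    R bound inv = Filled-weaken R (m≤m+n (5 * q) 12) inv
    smalls-run (suc n) {k} R bound inv =
      subst (λ m → Filled (5 * q) m R) (count-≡ n k)
        (smalls-run n R b (Filled-weaken (smalls q n R) (below-scale 12 40 (40 ^ n) (5 * q))
          (smallBlock-run (firstBin n) (offset q n) (40 ^ n) (smalls q n R) {{m^n≢0 40 n}} (offset-≡ q n b)
            (Filled-weaken (smalls q (suc n) R) (≤-reflexive (cong (5 * q +_) (*-assoc 12 40 (40 ^ n)))) inv))))
      where
      b = bound-pred n bound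
      count-≡ : ∀ n k → n * 2 + (2 + k) ≡ 2 + n * 2 + k
      count-≡ = solve-∀

    -- The innermost pair arrives first. The surplus 1560 s of `y` is 39 times the scale 40 s of the
    -- block it comes from. It outweighs the deficit 1160 s of its partner by 400 s, enough for the
    -- deficit 360 s of `2 * p + 840 * s`. The remaining pairs lower the excess to 40 s.
    mediumBlock-run : ∀ {k} b p s R y t .{{_ : NonZero s}} → q ≡ p + 600 * s →
      2 * q + 1560 * s ≤ y → y ≤ 3 * q → Filled (4 * q + 1200 * s) k (job t 0 y ∷ mediumBlock b p s R) →
      Filled (4 * q + 40 * s) (5 + k) (job (9 + b) 0 (2 * p + 1239 * s) ∷ R)
    mediumBlock-run b p s R y t refl y≥ y≤ inv =
      chunk₂ (4q + 40 * s) _ _ (2 * p + 1240 * s) (2 * p + 1240 * s) _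
        (chunk₂ (4q + 40 * s) _ _ (2 * p + 1240 * s) (2 * p + 1240 * s) _
          (chunk₂ (4q + 40 * s) _ _ (2 * p + 1600 * s) (2 * p + 840 * s) _
            (chunk₂ (4q + 400 * s) _ _ (2 * p + 1400 * s) (2 * p + 1400 * s) _
              (chunk₂ (4q + 400 * s) _ _ y (2 * p + 40 * s) _ inv
                first-overflows (medium-overflows 1200 40 p s)
                first-sum≤ (below-scale 400 1200 s 4q) first-sum≥)
              (medium-overflows 400 1400 p s) (medium-overflows 400 1400 p s)
              (≤-trans (≤-reflexive (sum₁ p s)) (upper 400)) ≤-refl (≤-reflexive (sym (sum₁ p s))))
            (medium-overflows 400 1600 p s) (medium-overflows 400 840 p s)
            (≤-trans (≤-reflexive (sum₂ p s)) (upper 40)) (below-scale 40 400 s 4q) (≤-reflexive (sym (sum₂ p s))))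
          (medium-overflows 40 1240 p s) (medium-overflows 40 1240 p s)
          (≤-trans (≤-reflexive (sum₃ p s)) (upper 80)) ≤-refl (≤-trans (below-scale 40 80 s 4q) (≤-reflexive (sym (sum₃ p s)))))
        (medium-overflows 40 1240 p s) (medium-overflows 40 1240 p s)
        (≤-trans (≤-reflexive (sum₃ p s)) (upper 80)) ≤-refl (≤-trans (below-scale 40 80 s 4q) (≤-reflexive (sym (sum₃ p s))))
      where
      4q = 4 * (p + 600 * s)
      sum₁ : ∀ p s → 2 * p + 1400 * s + (2 * p + 1400 * s) ≡ 4 * (p + 600 * s) + 400 * s
      sum₁ = solve-∀
      sum₂ : ∀ p s → 2 * p + 1600 * s + (2 * p + 840 * s) ≡ 4 * (p + 600 * s) + 40 * s
      sum₂ = solve-∀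
      sum₃ : ∀ p s → 2 * p + 1240 * s + (2 * p + 1240 * s) ≡ 4 * (p + 600 * s) + 80 * s
      sum₃ = solve-∀
      upper : ∀ a → {T (a ≤ᵇ 1200)} → 4q + a * s ≤ 6 * (p + 600 * s)
      upper a {le} = ≤-trans (below-scale a 1200 s 4q {le}) (gap (2 * p) (split p s))
        where
        split : ∀ p s → 4 * (p + 600 * s) + 1200 * s + 2 * p ≡ 6 * (p + 600 * s)
        split = solve-∀
      first-overflows : 6 * (p + 600 * s) < 4q + 1200 * s + y
      first-overflows = <-≤-trans (subst₂ _<_ (lhs p s) (rhs p s) (+-monoʳ-< (6 * (p + 600 * s)) (*-monoˡ-< s (<ᵇ⇒< 0 2760 _))))
        (+-monoʳ-≤ (4q + 1200 * s) y≥)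
        where
        lhs : ∀ p s → 6 * (p + 600 * s) + 0 * s ≡ 6 * (p + 600 * s)
        lhs = solve-∀
        rhs : ∀ p s → 6 * (p + 600 * s) + 2760 * s ≡ 4 * (p + 600 * s) + 1200 * s + (2 * (p + 600 * s) + 1560 * s)
        rhs = solve-∀
      first-sum≤ : y + (2 * p + 40 * s) ≤ 6 * (p + 600 * s)
      first-sum≤ = ≤-trans (+-monoˡ-≤ (2 * p + 40 * s) y≤) (gap (p + 1760 * s) (split p s))
        where
        split : ∀ p s → 3 * (p + 600 * s) + (2 * p + 40 * s) + (p + 1760 * s) ≡ 6 * (p + 600 * s)
        split = solve-∀
      first-sum≥ : 4q + 400 * s ≤ y + (2 * p + 40 * s)
      first-sum≥ = ≤-trans (≤-reflexive (split p s)) (+-monoˡ-≤ (2 * p + 40 * s) y≥)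
        where
        split : ∀ p s → 4 * (p + 600 * s) + 400 * s ≡ 2 * (p + 600 * s) + 1560 * s + (2 * p + 40 * s)
        split = solve-∀

    -- The unpaired item is carried through the induction. Each block leaves an excess of 40 s,
    -- above the 1200 s / 40 = 30 s that the next one needs.
    mediums-run : ∀ n {k} R y t → 2000 * 40 ^ n ≤ q → 2 * q + 39 * 40 ^ n ≤ y → y ≤ 3 * q →
      Filled (4 * q + 30 * 40 ^ n) k (job t 0 y ∷ mediums q n R) →
      Σ ℕ λ y′ → Σ ℕ λ t′ → 2 * q < y′ × y′ ≤ 3 * q × Filled (4 * q) (n * 5 + k) (job t′ 0 y′ ∷ R)
    mediums-run zero R y t bound y≥ y≤ inv = y , t ,
      ≤-trans (≤-trans (≤-reflexive (+-comm 1 (2 * q))) (+-monoʳ-≤ (2 * q) (≤ᵇ⇒≤ 1 39 _))) y≥ , y≤ ,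
      Filled-weaken (job t 0 y ∷ R) (m≤m+n (4 * q) 30) inv
    mediums-run (suc n) {k} R y t bound y≥ y≤ inv =
      let y′ , t′ , y′> , y′≤ , inv′ = mediums-run n R (2 * p + 1239 * s) (9 + firstBin n) b
            (≤-reflexive (trans (cong (λ q → 2 * q + 39 * s) (offset-≡ q n b)) (last p s)))
            (≤-trans (gap (p + 561 * s) (last′ p s)) (≤-reflexive (cong (3 *_) (sym (offset-≡ q n b)))))
            (Filled-weaken (job (9 + firstBin n) 0 (2 * p + 1239 * s) ∷ mediums q n R) (below-scale 30 40 s (4 * q))
              (mediumBlock-run (firstBin n) p s (mediums q n R) y t {{m^n≢0 40 n}} (offset-≡ q n b)
                (≤-trans (≤-reflexive (cong (2 * q +_) (*-assoc 39 40 s))) y≥) y≤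
                (Filled-weaken (job t 0 y ∷ mediums q (suc n) R) (≤-reflexive (cong (4 * q +_) (*-assoc 30 40 s))) inv)))
      in y′ , t′ , y′> , y′≤ , subst (λ m → Filled (4 * q) m (job t′ 0 y′ ∷ R)) (count-≡ n k) inv′
      where
      b = bound-pred n bound
      s = 40 ^ n
      p = offset q n
      last : ∀ p s → 2 * (p + 600 * s) + 39 * s ≡ 2 * p + 1239 * s
      last = solve-∀
      last′ : ∀ p s → 2 * p + 1239 * s + (p + 561 * s) ≡ 3 * (p + 600 * s)
      last′ = solve-∀
      count-≡ : ∀ n k → n * 5 + (5 + k) ≡ 5 + n * 5 + k
      count-≡ = solve-∀

    large-run : ∀ {k} t x R → suc (3 * q) ≤ x → x ≤ 6 * q → Filled (suc (3 * q)) k (job t 0 x ∷ R) →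
      Filled (suc (3 * q)) (suc k) R
    large-run t x R x≥ x≤ inv = chunk₁ (suc (3 * q)) t x R inv overflow x≤ ≤-refl x≥
      where
      double : ∀ q → suc (6 * q) + 1 ≡ suc (3 * q) + suc (3 * q)
      double = solve-∀
      overflow : 6 * q < suc (3 * q) + x
      overflow = ≤-trans (gap 1 (double q)) (+-monoʳ-≤ (suc (3 * q)) x≥)

    largeBlock-run : ∀ {k} b p s R .{{_ : NonZero s}} → q ≡ p + 600 * s → 1400 * s ≤ p →
      Filled (suc (3 * q)) k (largeBlock b p s R) → Filled (suc (3 * q)) (10 + k) R
    largeBlock-run b p s R refl 1400s≤p inv =
      large 1801 R (large 1840 _ (large 1840 _ (large 1840 _ (large 1840 _
        (large 1840 _ (large 1840 _ (large 1840 _ (large 1840 _ (large 1840 _ inv)))))))))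
      where
      lower : ∀ p s → 3 * p + 1800 * s ≡ 3 * (p + 600 * s)
      lower = solve-∀
      large : ∀ a R {k t} {lt : T (1800 <ᵇ a)} {le : T (a ≤ᵇ 3600)} →
        Filled (suc (3 * (p + 600 * s))) k (job t 0 (3 * p + a * s) ∷ R) → Filled (suc (3 * (p + 600 * s))) (suc k) R
      large a R {lt = lt} {le} = large-run _ (3 * p + a * s) R
        (≤-trans (s≤s (≤-reflexive (sym (lower p s)))) (+-monoʳ-< (3 * p) (*-monoˡ-< s (<ᵇ⇒< 1800 a lt))))
        (proj₂ (wide-range 3 a {p} {s} {_} {_} {le} 1400s≤p))

    larges-run : ∀ n {k} → 2000 * 40 ^ n ≤ q → Filled (suc (3 * q)) k (larges q n []) →
      Filled (suc (3 * q)) (n * 10 + k) []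
    larges-run zero    bound inv = inv
    larges-run (suc n) {k} bound inv = subst (λ m → Filled (suc (3 * q)) m []) (count-≡ n k)
      (larges-run n b (largeBlock-run (firstBin n) (offset q n) (40 ^ n) (larges q n []) {{m^n≢0 40 n}}
        (offset-≡ q n b) (offset-≥ q n b) inv))
      where
      b = bound-pred n bound
      count-≡ : ∀ n k → n * 10 + (10 + k) ≡ 10 + n * 10 + k
      count-≡ = solve-∀

    -- Per block there are two bins of five small items, five of two medium items and ten of one
    -- large item: 17 bins where the optimum uses 10.
    jobs-run : ∀ n → 2000 * 40 ^ n ≤ q →
      Filled (6 * q) 0 (smalls q n (half q ∷ mediums q n (half q ∷ larges q n []))) →
      Filled (suc (3 * q)) (n * 10 + suc (n * 5 + (n * 2 + 0))) []
    jobs-run n bound inv =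
      let s = 40 ^ n
          1≤q = ≤-trans (*-mono-≤ {1} {2000} (s≤s z≤n) (m^n>0 40 n)) bound
          scaled-≤q = λ a (le : T (a ≤ᵇ 2000)) → ≤-trans (*-monoˡ-≤ s (≤ᵇ⇒≤ a 2000 le)) bound
          inv₁ = smalls-run n _ bound (Filled-weaken (smalls q n (half q ∷ mediums q n (half q ∷ larges q n [])))
            (≤-trans (+-monoʳ-≤ (5 * q) (scaled-≤q 12 _)) (≤-reflexive (5q+q q))) inv)
          y , t , y> , y≤ , inv₂ = mediums-run n (half q ∷ larges q n []) (3 * q) 1 bound
            (≤-trans (+-monoʳ-≤ (2 * q) (scaled-≤q 39 _)) (≤-reflexive (2q+q q))) ≤-refl
            (Filled-weaken (half q ∷ mediums q n (half q ∷ larges q n []))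
              (≤-trans (+-monoʳ-≤ (4 * q) (scaled-≤q 30 _)) (≤-reflexive (4q+q q))) inv₁)
          -- The leftover medium item with the second half: the one bin beyond the count per block.
          inv₃ = chunk₂ (suc (3 * q)) t 1 y (3 * q) (larges q n []) inv₂
            (subst (_< 4 * q + y) (4q+2q q) (+-monoʳ-< (4 * q) y>))
            (≤-trans (+-monoˡ-≤ (6 * q) 1≤q) (≤-reflexive (q+6q q)))
            (≤-trans (+-monoˡ-≤ (3 * q) y≤) (≤-reflexive (3q+3q q)))
            (+-monoˡ-≤ (3 * q) 1≤q)
            (+-monoˡ-≤ (3 * q) (≤-trans (s≤s z≤n) y>))
      in larges-run n bound inv₃
      where
      5q+q : ∀ q → 5 * q + q ≡ 6 * q
      5q+q = solve-∀
      2q+q : ∀ q → 2 * q + q ≡ 3 * q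
      2q+q = solve-∀
      4q+q : ∀ q → 4 * q + q ≡ 5 * q
      4q+q = solve-∀
      4q+2q : ∀ q → 4 * q + 2 * q ≡ 6 * q
      4q+2q = solve-∀
      q+6q : ∀ q → q + 6 * q ≡ 4 * q + 3 * q
      q+6q = solve-∀
      3q+3q : ∀ q → 3 * q + 3 * q ≡ 6 * q
      3q+3q = solve-∀

  -- Both statements share one ε, which the other instance forces to be small, so the bound 1/8 on
  -- the sizes has to be compared with every smaller power of 1/2.
  eps-mono : ∀ j k → eps (k + j) ℚ.≤ eps j
  eps-mono j zero    = ℚₚ.≤-refl
  eps-mono j (suc k) = ℚₚ.≤-trans halve (eps-mono j k)
    where
    D = 2 ^ suc (k + j)
    instance
      D≢0 : NonZero D
      D≢0 = m^n≢0 2 (suc (k + j))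
      D*1≢0 : NonZero (D * 1)
      D*1≢0 = m*n≢0 D 1
      E≢0 : NonZero (2 ^ (k + j))
      E≢0 = m^n≢0 2 (k + j)
    halve : eps (suc (k + j)) ℚ.≤ eps (k + j)
    halve = subst₂ ℚ._≤_ (sym (eps≡ (suc (k + j))))
      (trans (÷-cross 2 D 1 (2 ^ (k + j)) (sym (*-identityˡ D))) (sym (eps≡ (k + j))))
      (÷-mono-≤ D (s≤s z≤n))

  eps≤size : ∀ q j x .{{_ : NonZero (6 * q)}} → 3 ≤ j → 3 * q ≤ 4 * x → eps j ℚ.≤ x ÷ (6 * q)
  eps≤size q j x 3≤j 3q≤4x = ℚₚ.≤-trans (subst (λ i → eps i ℚ.≤ eps 3) (m∸n+n≡m 3≤j) (eps-mono 3 (j ∸ 3)))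
    (subst₂ ℚ._≤_ (trans (÷-cross (6 * q) (8 * (6 * q)) 1 8 (trans (*-comm (6 * q) 8) (sym (*-identityˡ _)))) (sym (eps≡ 3)))
      (÷-cross (8 * x) (8 * (6 * q)) x (6 * q) (eightfold x (6 * q)))
      (÷-mono-≤ (8 * (6 * q)) (subst₂ _≤_ (six q) (eight x) (*-monoʳ-≤ 2 3q≤4x))))
    where
    instance
      8D≢0 : NonZero (8 * (6 * q))
      8D≢0 = m*n≢0 8 (6 * q)
    six : ∀ q → 2 * (3 * q) ≡ 6 * q
    six = solve-∀
    eight : ∀ x → 2 * (4 * x) ≡ 8 * x
    eight = solve-∀
    eightfold : ∀ x d → 8 * x * d ≡ x * (8 * d)
    eightfold = solve-∀

  range⇒SizesIn : ∀ q j T .{{_ : NonZero (6 * q)}} → 3 ≤ j → All (InRange q ∘ units) T → SizesIn j (toItems (6 * q) T)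
  range⇒SizesIn q j []      3≤j []            = tt
  range⇒SizesIn q j (t ∷ T) 3≤j ((lo , hi) ∷ rs) =
    (eps≤size q j (units t) 3≤j lo , ℚₚ.≤-trans (÷-mono-≤ (6 * q) hi) (ℚₚ.≤-reflexive (d÷d≡1 (6 * q)))) , range⇒SizesIn q j T 3≤j rs

  module _ (q : ℕ) .{{6q≢0 : NonZero (6 * q)}} (n : ℕ) (bound : 2000 * 40 ^ n ≤ q) where

    jobs-OPT : IsOPT (colourPart 0 (toItems (6 * q) (jobs q n))) (2 + n * 10)
    jobs-OPT = subst (λ I → IsOPT I (2 + n * 10)) (sym (filter-all (λ e → colour e ≟ 0) (map⁺ (jobs-colour q n))))
      (perfect⇒OPT (6 * q) (2 + n * 10) (jobs q n) (All.map (λ {t} → positive {t}) (jobs-range q n bound)) (jobs-perfect q n bound))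
      where
      1≤q : 1 ≤ q
      1≤q = ≤-trans (*-mono-≤ {1} {2000} (s≤s z≤n) (m^n>0 40 n)) bound
      positive : ∀ {t} → InRange q (units t) → 0 < units t
      positive {job _ _ zero}    (lo , _) = ≤-trans (*-mono-≤ {1} {3} (s≤s z≤n) 1≤q) lo
      positive {job _ _ (suc _)} _        = s≤s z≤n

    jobs-Pc : ∀ v j → 1 ≤ j → Pc v j (toItems (6 * q) (jobs q n)) 0 ≡ 2 + n * 17
    jobs-Pc v j 1≤j = begin
      Pc v j (toItems (6 * q) (jobs q n)) 0        ≡⟨ Pc-∷ v j first (toItems (6 * q) later) 0 ⟩
      coloured (process v j start (toItems (6 * q) later)) ≡⟨ cong coloured (trans (sym (proj₁ (proj₂ reached))) (process-[] v j _)) ⟩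
      coloured (proj₁ reached)                             ≡⟨ Served-Pc (6 * q) v j 0 (proj₂ (proj₂ reached)) ⟩
      suc (n * 10 + suc (n * 5 + (n * 2 + 0)))             ≡⟨ total n ⟩
      2 + n * 17                                           ∎
      where
      open ≡-Reasoning
      coloured : State → ℕ
      coloured st = length (filter (λ b → T? (hasColour 0 b)) st)
      first : Item
      first = item ((6 * q) ÷ (6 * q)) 0
      start : State
      start = step v j [] first
      later : List Job
      later = smalls q n (half q ∷ mediums q n (half q ∷ larges q n []))
      reached : Reaches (6 * q) v j 0 (suc (3 * q)) (n * 10 + suc (n * 5 + (n * 2 + 0)))
        (process v j start (toItems (6 * q) later)) []
      reached = reaches (jobs-run q v j (process v j start (toItems (6 * q) later)) n bound
        (filled (start , refl , serve-first (6 * q) v j 0 1≤j)))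
      total : ∀ n → suc (n * 10 + suc (n * 5 + (n * 2 + 0))) ≡ 2 + n * 17
      total = solve-∀

  bbf-instance : ∀ v j n → 3 ≤ j → Σ Instance λ I →
    SizesIn j I × IsOPT (colourPart 0 I) (2 + n * 10) × Pc v j I 0 ≡ 2 + n * 17
  bbf-instance v j n 3≤j = toItems (6 * q) (jobs q n) , range⇒SizesIn q j (jobs q n) 3≤j (jobs-range q n ≤-refl) ,
    jobs-OPT q n ≤-refl , jobs-Pc q n ≤-refl v j (≤-trans (s≤s z≤n) 3≤j)
    where
    q = 2000 * 40 ^ n
    instance
      6q≢0 : NonZero (6 * q)
      6q≢0 = m*n≢0 6 q {{_}} {{m*n≢0 2000 (40 ^ n) {{_}} {{m^n≢0 40 n}}}}

-- Level bins when every item overflows its colour's regions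

module LevelRun where
  open import Data.Bool using (Bool; true; false; if_then_else_; _∧_; _∨_)
  open import Data.Bool.ListAction using (any)
  open import Data.Nat
  open import Data.Nat.Properties
  open import Algebra.Properties.CommutativeSemigroup +-commutativeSemigroup using (x∙yz≈y∙xz)
  open import Data.Rational as ℚ using (ℚ)
  open import Data.List using (List; []; _∷_; _++_; map; length)
  open import Data.List.Properties using (length-++)
  open import Data.List.Relation.Unary.All as All using (All; []; _∷_)
  open import Data.List.Relation.Unary.All.Properties using (++⁺)
  open import Data.List.Relation.Unary.Any using (Any; here; there)
  open import Data.List.Membership.Propositional using (_∈_)
  open import Data.Product using (Σ; _×_; _,_; proj₂)
  open import Data.Sum using (_⊎_; inj₁; inj₂)
  open import Data.Empty using (⊥-elim)
  open import Relation.Binary.PropositionalEquality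
  open import Data.Nat.Tactic.RingSolver using (solve-∀)
  open Fractions
  open Packings
  open BoundedBestFit using (lowestLevel-fits; process; process-∷)

  mutual
    insertRegion : ℕ → ℕ → ℕ → ℚ → State → State → State
    insertRegion = _

    newRegion-∷ : ∀ j c l s k rs st → (l ≡ᵇ j) ≡ false →
      newRegion j c l s (bin k rs ∷ st) ≡
        (if isLvl l k ∧ (length rs <ᵇ 2 ^ (j ∸ l)) then bin k (rs ++ reg c s ∷ []) ∷ st
         else bin k rs ∷ insertRegion j c l s (bin k rs ∷ st) st)
    newRegion-∷ j c l s k rs st eq with l ≡ᵇ j | bin k rs ∷ st
    newRegion-∷ j c l s k rs st refl | false | whole = refl

  -- The local loop of `newRegion` as a recursive function of the state alone, so that induction
  -- over the bins applies.
  insert : ℕ → ℕ → ℕ → ℚ → State → State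
  insert j c l s []              = bin (lvl l) (reg c s ∷ []) ∷ []
  insert j c l s (bin k rs ∷ st) =
    if isLvl l k ∧ (length rs <ᵇ 2 ^ (j ∸ l)) then bin k (rs ++ reg c s ∷ []) ∷ st
    else bin k rs ∷ insert j c l s st

  insertRegion≡insert : ∀ j c l s whole st → insertRegion j c l s whole st ≡ insert j c l s st
  insertRegion≡insert j c l s whole []              = refl
  insertRegion≡insert j c l s whole (bin k rs ∷ st) =
    cong (λ rest → if isLvl l k ∧ (length rs <ᵇ 2 ^ (j ∸ l)) then bin k (rs ++ reg c s ∷ []) ∷ st else bin k rs ∷ rest)
      (insertRegion≡insert j c l s whole st)

  newRegion≡insert : ∀ j c l s st → l < j → newRegion j c l s st ≡ insert j c l s st
  newRegion≡insert j c l s [] l<j rewrite ≢⇒≡ᵇ-false (<⇒≢ l<j) = refl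
  newRegion≡insert j c l s (bin k rs ∷ st) l<j = trans (newRegion-∷ j c l s k rs st (≢⇒≡ᵇ-false (<⇒≢ l<j)))
    (cong (λ rest → if isLvl l k ∧ (length rs <ᵇ 2 ^ (j ∸ l)) then bin k (rs ++ reg c s ∷ []) ∷ st else bin k rs ∷ rest)
      (insertRegion≡insert j c l s (bin k rs ∷ st) st))

  mutual
    firstLoad : ℕ → ℕ → Kind → List Region → State → List Region → ℚ
    firstLoad = _

    -- The first region is passed over so that the local search is met on `rs`, distinct from the
    -- whole list, which it carries as a parameter.
    regionLoad-∷ : ∀ c l k r rs st → isLvl l k ≡ true → (col r ≡ᵇ c) ≡ false → any (λ r → col r ≡ᵇ c) rs ≡ true →
      regionLoad c l (bin k (r ∷ rs) ∷ st) ≡ firstLoad c l k (r ∷ rs) st rs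
    regionLoad-∷ c l k r rs st p q s with isLvl l k | col r ≡ᵇ c | any (λ r → col r ≡ᵇ c) rs | r ∷ rs
    regionLoad-∷ c l k r rs st refl refl refl | true | false | true | whole = refl

  firstLoad-uniform : ∀ c l k whole st rs x → any (λ r → col r ≡ᵇ c) rs ≡ true →
    All (λ r → (col r ≡ᵇ c) ≡ true → load r ≡ x) rs → firstLoad c l k whole st rs ≡ x
  firstLoad-uniform c l k whole st (r ∷ rs) x some (u ∷ us) with col r ≡ᵇ c
  ... | true  = u refl
  ... | false = firstLoad-uniform c l k whole st rs x some us

  regionLoad-first : ∀ c l k r rs st → isLvl l k ≡ true → (col r ≡ᵇ c) ≡ true →
    regionLoad c l (bin k (r ∷ rs) ∷ st) ≡ load r
  regionLoad-first c l k r rs st p eq rewrite p | eq = refl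

  regionLoad-uniform : ∀ c l k rs st x → isLvl l k ≡ true → any (λ r → col r ≡ᵇ c) rs ≡ true →
    All (λ r → (col r ≡ᵇ c) ≡ true → load r ≡ x) rs → regionLoad c l (bin k rs ∷ st) ≡ x
  regionLoad-uniform c l k (r ∷ rs) st x p some (u ∷ us) = cases (col r ≡ᵇ c) refl
    where
    cases : ∀ b → (col r ≡ᵇ c) ≡ b → regionLoad c l (bin k (r ∷ rs) ∷ st) ≡ x
    cases true  eq = trans (regionLoad-first c l k r rs st p eq) (u eq)
    cases false eq = trans (regionLoad-∷ c l k r rs st p eq some′) (firstLoad-uniform c l k (r ∷ rs) st rs x some′ us)
      where
      some′ : any (λ r → col r ≡ᵇ c) rs ≡ true
      some′ = trans (cong (_∨ any (λ r → col r ≡ᵇ c) rs) (sym eq)) some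

  regionLoad-skip : ∀ c l k rs st → (isLvl l k ∧ any (λ r → col r ≡ᵇ c) rs) ≡ false →
    regionLoad c l (bin k rs ∷ st) ≡ regionLoad c l st
  regionLoad-skip c l k rs st eq rewrite eq = refl

  fitsIn : ℕ → State → Item → ℕ → Bool
  fitsIn j st e i = fits j (size e) (regionLoad (colour e) i st) i

  mutual
    scanMFF : ℕ → State → Item → ℕ → List ℕ → List ℕ → State
    scanMFF = _

    -- Two levels have to fail before the local scan is met on a list other than the tail `y ∷ zs`,
    -- which it carries as a parameter.
    step-MFF : ∀ j st e x y zs → inBBF (colour e) st ≡ false → levelsOf (colour e) st ≡ x ∷ y ∷ zs →
      fitsIn j st e x ≡ false → fitsIn j st e y ≡ false →
      step MFF j st e ≡ scanMFF j st e x (y ∷ zs) zs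
    step-MFF j st e x y zs p q r s with inBBF (colour e) st | levelsOf (colour e) st
    step-MFF j st e x y zs refl refl r s | .false | .(x ∷ y ∷ zs)
      with fits j (size e) (regionLoad (colour e) x st) x | fits j (size e) (regionLoad (colour e) y st) y | y ∷ zs
    step-MFF j st e x y zs refl refl refl refl | .false | .(x ∷ y ∷ zs) | .false | .false | whole = refl

  scanMFF-none : ∀ j st e x whole is → All (λ i → fitsIn j st e i ≡ false) is →
    scanMFF j st e x whole is ≡
      newRegion j (colour e) (lowestLevel j (size e) (suc (maxList (x ∷ whole)))) (size e) st
  scanMFF-none j st e x whole []       []       = refl
  scanMFF-none j st e x whole (i ∷ is) (p ∷ ps) rewrite p = scanMFF-none j st e x whole is ps

  -- The last hypothesis answers the test of MNF, the one before it the tests of MFF; after that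
  -- both open the same new region.
  step-none : ∀ v j st e x xs → inBBF (colour e) st ≡ false → levelsOf (colour e) st ≡ x ∷ xs →
    All (λ i → fitsIn j st e i ≡ false) (x ∷ xs) → fitsIn j st e (maxList (x ∷ xs)) ≡ false →
    step v j st e ≡ newRegion j (colour e) (lowestLevel j (size e) (suc (maxList (x ∷ xs)))) (size e) st
  step-none MNF j st e x xs       p q rs           t rewrite p | q | t = refl
  step-none MFF j st e x []       p q (r ∷ [])     t rewrite p | q | r = refl
  step-none MFF j st e x (y ∷ zs) p q (r ∷ s ∷ ps) t =
    trans (step-MFF j st e x y zs p q r s) (scanMFF-none j st e x (y ∷ zs) zs ps)

  step-fresh : ∀ v j st e → inBBF (colour e) st ≡ false → levelsOf (colour e) st ≡ [] →
    step v j st e ≡ newRegion j (colour e) (lowestLevel j (size e) 1) (size e) st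
  step-fresh v j st e p q rewrite p | q = refl

  ≤maxList : ∀ {i is} → i ∈ is → i ≤ maxList is
  ≤maxList {is = x ∷ is} (here refl) = m≤m⊔n x (maxList is)
  ≤maxList {is = x ∷ is} (there i∈)  = ≤-trans (≤maxList i∈) (m≤n⊔m x (maxList is))

  maxList≤ : ∀ {m} is → (∀ {i} → i ∈ is → i ≤ m) → maxList is ≤ m
  maxList≤ []       bound = z≤n
  maxList≤ (x ∷ is) bound = ⊔-lub (bound (here refl)) (maxList≤ is (λ i∈ → bound (there i∈)))

  HasLevel : ℕ → ℕ → State → Set
  HasLevel c l = Any (λ b → (isLvl l (kind b) ∧ hasColour c b) ≡ true)

  HasLevel-tail : ∀ {c l b st} → (isLvl l (kind b) ∧ hasColour c b) ≡ false → HasLevel c l (b ∷ st) → HasLevel c l st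
  HasLevel-tail eq (there h) = h
  HasLevel-tail eq (here eq′) with trans (sym eq) eq′
  ... | ()

  ∈-levelsOf⇒HasLevel : ∀ c {i} st → i ∈ levelsOf c st → HasLevel c i st
  ∈-levelsOf⇒HasLevel c (bin (iso _) rs ∷ st) i∈ = there (∈-levelsOf⇒HasLevel c st i∈)
  ∈-levelsOf⇒HasLevel c (bin (lvl l) rs ∷ st) i∈ with any (λ r → col r ≡ᵇ c) rs in eq
  ∈-levelsOf⇒HasLevel c (bin (lvl l) rs ∷ st) i∈          | false = there (∈-levelsOf⇒HasLevel c st i∈)
  ∈-levelsOf⇒HasLevel c (bin (lvl l) rs ∷ st) (here refl) | true  = here (cong₂ _∧_ (≡ᵇ-refl l) eq)
  ∈-levelsOf⇒HasLevel c (bin (lvl l) rs ∷ st) (there i∈)  | true  = there (∈-levelsOf⇒HasLevel c st i∈)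

  ∧-true : ∀ x y → (x ∧ y) ≡ true → x ≡ true × y ≡ true
  ∧-true true true _ = refl , refl

  ≡ᵇ-true : ∀ {x y} → (x ≡ᵇ y) ≡ true → x ≡ y
  ≡ᵇ-true {x} {y} eq = ≡ᵇ⇒≡ x y (≡true⇒T eq)

  HasLevel⇒∈-levelsOf : ∀ c {i} st → HasLevel c i st → i ∈ levelsOf c st
  HasLevel⇒∈-levelsOf c (bin (iso _) rs ∷ st) (there h) = HasLevel⇒∈-levelsOf c st h
  HasLevel⇒∈-levelsOf c {i} (bin (lvl l) rs ∷ st) (here eq) with ∧-true (l ≡ᵇ i) (any (λ r → col r ≡ᵇ c) rs) eq
  ... | l≡i , some rewrite some = here (sym (≡ᵇ-true l≡i))
  HasLevel⇒∈-levelsOf c (bin (lvl l) rs ∷ st) (there h) with any (λ r → col r ≡ᵇ c) rs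
  ... | true  = there (HasLevel⇒∈-levelsOf c st h)
  ... | false = HasLevel⇒∈-levelsOf c st h

  volumeBin : Bin → ℕ
  volumeBin (bin (lvl l) rs) = 2 ^ l * length rs
  volumeBin (bin (iso _) rs) = 0

  -- Regions of level l weigh 2 ^ l, so that no bin weighs more than 2 ^ j.
  volume : State → ℕ
  volume []       = 0
  volume (b ∷ st) = volumeBin b + volume st

  volume-insert : ∀ j c l s st → volume (insert j c l s st) ≡ 2 ^ l + volume st
  volume-insert j c l s [] = cong (_+ 0) (*-identityʳ (2 ^ l))
  volume-insert j c l s (bin (iso _) rs ∷ st) = volume-insert j c l s st
  volume-insert j c l s (bin (lvl i) rs ∷ st) with i ≡ᵇ l in eq | length rs <ᵇ 2 ^ (j ∸ l)
  ... | false | _     = trans (cong (2 ^ i * length rs +_) (volume-insert j c l s st)) (x∙yz≈y∙xz (2 ^ i * length rs) (2 ^ l) (volume st))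
  ... | true  | false = trans (cong (2 ^ i * length rs +_) (volume-insert j c l s st)) (x∙yz≈y∙xz (2 ^ i * length rs) (2 ^ l) (volume st))
  ... | true  | true rewrite ≡ᵇ-true {i} {l} eq | length-++ rs {reg c s ∷ []} = expand (2 ^ l) (length rs) (volume st)
    where
    expand : ∀ a b c → a * (b + 1) + c ≡ a + (a * b + c)
    expand = solve-∀

  any-snoc : ∀ c s rs → any (λ r → col r ≡ᵇ c) (rs ++ reg c s ∷ []) ≡ true
  any-snoc c s []       rewrite ≡ᵇ-refl c = refl
  any-snoc c s (r ∷ rs) with col r ≡ᵇ c
  ... | true  = refl
  ... | false = any-snoc c s rs

  HasLevel-insert : ∀ j c l s st → HasLevel c l (insert j c l s st)
  HasLevel-insert j c l s [] = here (cong₂ _∧_ (≡ᵇ-refl l) (any-snoc c s []))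
  HasLevel-insert j c l s (bin (iso _) rs ∷ st) = there (HasLevel-insert j c l s st)
  HasLevel-insert j c l s (bin (lvl i) rs ∷ st) with i ≡ᵇ l in eq | length rs <ᵇ 2 ^ (j ∸ l)
  ... | false | _     = there (HasLevel-insert j c l s st)
  ... | true  | false = there (HasLevel-insert j c l s st)
  ... | true  | true  = here (cong₂ _∧_ eq (any-snoc c s rs))

  module _ (j D : ℕ) .{{_ : NonZero D}} (a : ℕ → ℕ) where

    -- Colours are served in increasing order. Of a finished colour only `col r < c` is remembered,
    -- since its regions are never consulted again.
    RegionOK : ℕ → ℕ → ℕ → Region → Set
    RegionOK c k l r = (col r < c) ⊎ (col r ≡ c × 1 ≤ l × l ≤ k × load r ≡ a l ÷ D)

    data BinOK (c k : ℕ) : Bin → Set where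
      ok : ∀ {l rs} → l ≤ j → length rs ≤ 2 ^ (j ∸ l) → All (RegionOK c k l) rs → BinOK c k (bin (lvl l) rs)

    inBBF-false : ∀ c′ {c k st} → All (BinOK c k) st → inBBF c′ st ≡ false
    inBBF-false c′ []              = refl
    inBBF-false c′ (ok _ _ _ ∷ bs) = inBBF-false c′ bs

    region-level : ∀ {c k l} rs → any (λ r → col r ≡ᵇ c) rs ≡ true → All (RegionOK c k l) rs → 1 ≤ l × l ≤ k
    region-level {c} (r ∷ rs) some (o ∷ os) with col r ≡ᵇ c in eq
    region-level (r ∷ rs) some (o ∷ os)                        | false = region-level rs some os
    region-level (r ∷ rs) some (inj₁ r<c ∷ os)                 | true  = ⊥-elim (<⇒≢ r<c (≡ᵇ-true eq))
    region-level (r ∷ rs) some (inj₂ (_ , 1≤l , l≤k , _) ∷ os) | true  = 1≤l , l≤k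

    region-load : ∀ {c k l r} → RegionOK c k l r → (col r ≡ᵇ c) ≡ true → load r ≡ a l ÷ D
    region-load (inj₁ r<c)             eq = ⊥-elim (<⇒≢ r<c (≡ᵇ-true eq))
    region-load (inj₂ (_ , _ , _ , q)) eq = q

    HasLevel-bound : ∀ {c k i st} → All (BinOK c k) st → HasLevel c i st → 1 ≤ i × i ≤ k
    HasLevel-bound (_ ∷ bs)                     (there h) = HasLevel-bound bs h
    HasLevel-bound {c} {k} {i} (ok {l} {rs} l≤j len os ∷ bs) (here eq) with ∧-true (l ≡ᵇ i) (any (λ r → col r ≡ᵇ c) rs) eq
    ... | l≡i , some with ≡ᵇ-true {l} {i} l≡i
    ... | refl = region-level rs some os

    -- All regions of colour `c` on one level carry the same load, so the answer does not depend on
    -- which of them `regionLoad` finds first.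
    HasLevel-load : ∀ {c k i} st → All (BinOK c k) st → HasLevel c i st → regionLoad c i st ≡ a i ÷ D
    HasLevel-load {c} {k} {i} (bin (lvl l) rs ∷ st) (ok l≤j len os ∷ bs) h = cases ((l ≡ᵇ i) ∧ any (λ r → col r ≡ᵇ c) rs) refl
      where
      cases : ∀ b → ((l ≡ᵇ i) ∧ any (λ r → col r ≡ᵇ c) rs) ≡ b → regionLoad c i (bin (lvl l) rs ∷ st) ≡ a i ÷ D
      cases true eq with ∧-true (l ≡ᵇ i) (any (λ r → col r ≡ᵇ c) rs) eq
      ... | l≡i , some with ≡ᵇ-true {l} {i} l≡i
      ... | refl = regionLoad-uniform c l (lvl l) rs st (a l ÷ D) l≡i some (All.map region-load os)
      cases false eq = trans (regionLoad-skip c i (lvl l) rs st eq) (HasLevel-load st bs (HasLevel-tail eq h))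

    insert-ok : ∀ {c k} st → suc k ≤ j → All (BinOK c k) st → All (BinOK c (suc k)) (insert j c (suc k) (a (suc k) ÷ D) st)
    insert-ok {c} {k} [] k<j [] = ok k<j (m^n>0 2 (j ∸ suc k)) (inj₂ (refl , s≤s z≤n , ≤-refl , refl) ∷ []) ∷ []
    insert-ok {c} {k} (bin (lvl i) rs ∷ st) k<j (ok i≤j len os ∷ bs) = cases (i ≡ᵇ suc k) (length rs <ᵇ 2 ^ (j ∸ suc k)) refl refl
      where
      weaken : ∀ {l r} → RegionOK c k l r → RegionOK c (suc k) l r
      weaken (inj₁ r<c)                  = inj₁ r<c
      weaken (inj₂ (eq , 1≤l , l≤k , q)) = inj₂ (eq , 1≤l , m≤n⇒m≤1+n l≤k , q)
      weakenBin : ∀ {b} → BinOK c k b → BinOK c (suc k) b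
      weakenBin (ok l≤j len os) = ok l≤j len (All.map weaken os)
      cases : ∀ b b′ → (i ≡ᵇ suc k) ≡ b → (length rs <ᵇ 2 ^ (j ∸ suc k)) ≡ b′ →
        All (BinOK c (suc k)) (insert j c (suc k) (a (suc k) ÷ D) (bin (lvl i) rs ∷ st))
      cases false b′    eq eq′ rewrite eq = weakenBin (ok i≤j len os) ∷ insert-ok st k<j bs
      cases true  false eq eq′ rewrite eq | eq′ = weakenBin (ok i≤j len os) ∷ insert-ok st k<j bs
      cases true  true  eq eq′ with ≡ᵇ-true {i} {suc k} eq
      ... | refl rewrite eq | eq′ =
        ok k<j (≤-trans (≤-reflexive (trans (length-++ rs) (+-comm (length rs) 1))) (<ᵇ⇒< (length rs) _ (≡true⇒T eq′)))
          (++⁺ (All.map weaken os) (inj₂ (refl , s≤s z≤n , ≤-refl , refl) ∷ [])) ∷ All.map weakenBin bs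

    next-colour : ∀ {c k st} → All (BinOK c k) st → All (BinOK (suc c) 0) st
    next-colour = All.map bins
      where
      regions′ : ∀ {c k l r} → RegionOK c k l r → RegionOK (suc c) 0 l r
      regions′ (inj₁ r<c)        = inj₁ (m<n⇒m<1+n r<c)
      regions′ (inj₂ (refl , _)) = inj₁ ≤-refl
      bins : ∀ {c k b} → BinOK c k b → BinOK (suc c) 0 b
      bins (ok l≤j len os) = ok l≤j len (All.map regions′ os)

    volume-bound : ∀ {c k} st → All (BinOK c k) st → volume st ≤ 2 ^ j * length st
    volume-bound [] [] = z≤n
    volume-bound (bin (lvl l) rs ∷ st) (ok l≤j len os ∷ bs) = begin
      2 ^ l * length rs + volume st          ≤⟨ +-mono-≤ (*-monoʳ-≤ (2 ^ l) len) (volume-bound st bs) ⟩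
      2 ^ l * 2 ^ (j ∸ l) + 2 ^ j * length st ≡⟨ cong (_+ 2 ^ j * length st) (^-distribˡ-+-* 2 l (j ∸ l)) ⟨
      2 ^ (l + (j ∸ l)) + 2 ^ j * length st   ≡⟨ cong (λ i → 2 ^ i + 2 ^ j * length st) (m+[n∸m]≡n l≤j) ⟩
      2 ^ j + 2 ^ j * length st              ≡⟨ *-suc (2 ^ j) (length st) ⟨
      2 ^ j * suc (length st)                ∎
      where open ≤-Reasoning

  -- In units of 1 / D a region of level l has size 2 ^ l * u.
  module Levels (j u : ℕ) .{{_ : NonZero (2 ^ j * u)}} (a : ℕ → ℕ)
    (a-overflows : ∀ {l k} → l ≤ k → 2 ^ l * u < a l + a (suc k))
    (a-fits : ∀ k → a (suc k) ≤ 2 ^ suc k * u) where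

    D : ℕ
    D = 2 ^ j * u

    cell : ℕ → ℕ → Item
    cell c k = item (a k ÷ D) c

    fits-false : ∀ {c k} st i → All (BinOK j D a c k) st → i ∈ levelsOf c st → fitsIn j st (cell c (suc k)) i ≡ false
    fits-false {c} {k} st i bs i∈ = ≤ᵇ-false (subst₂ ℚ._<_ (sym (regionSize-scaled j i u))
      (sym (trans (cong (ℚ._+ a (suc k) ÷ D) (HasLevel-load j D a st bs h)) (÷-+ (a i) (a (suc k)) D)))
      (÷-mono-< D (a-overflows (proj₂ (HasLevel-bound j D a bs h)))))
      where
      h : HasLevel c i st
      h = ∈-levelsOf⇒HasLevel c st i∈

    lowestLevel-next : ∀ k → suc k < j → lowestLevel j (a (suc k) ÷ D) (suc k) ≡ suc k
    lowestLevel-next k k<j = lowestLevel-fits j _ (suc k) k<j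
      (subst (a (suc k) ÷ D ℚ.≤_) (sym (regionSize-scaled j (suc k) u)) (÷-mono-≤ D (a-fits k)))

    -- All levels held by the colour are at most `k`, so by `a-overflows` none of its regions takes
    -- item k + 1. The search then starts at level k + 1 and, by `a-fits`, stops there; staying
    -- below `j` keeps the colour out of isolated bins.
    step-cell : ∀ v c k st → suc k < j → All (BinOK j D a c k) st → (1 ≤ k → HasLevel c k st) →
      step v j st (cell c (suc k)) ≡ insert j c (suc k) (a (suc k) ÷ D) st
    step-cell v c k st k<j bs has = trans (cases (levelsOf c st) refl) (newRegion≡insert j c (suc k) s st k<j)
      where
      s : ℚ
      s = a (suc k) ÷ D
      k∈ : 1 ≤ k → k ∈ levelsOf c st
      k∈ 1≤k = HasLevel⇒∈-levelsOf c st (has 1≤k)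
      bounds : ∀ {i} → i ∈ levelsOf c st → 1 ≤ i × i ≤ k
      bounds i∈ = HasLevel-bound j D a bs (∈-levelsOf⇒HasLevel c st i∈)
      cases : ∀ is → levelsOf c st ≡ is → step v j st (cell c (suc k)) ≡ newRegion j c (suc k) s st
      cases [] eq = trans (step-fresh v j st (cell c (suc k)) (inBBF-false j D a c bs) eq)
        (cong (λ l → newRegion j c l s st) (trans (cong (λ i → lowestLevel j s (suc i)) (sym (k≡0 k k∈))) (lowestLevel-next k k<j)))
        where
        k≡0 : ∀ i → (1 ≤ i → i ∈ levelsOf c st) → i ≡ 0
        k≡0 zero    _  = refl
        k≡0 (suc i) i∈ with subst (suc i ∈_) eq (i∈ (s≤s z≤n))
        ... | ()
      cases is@(x ∷ xs) eq = trans
        (step-none v j st (cell c (suc k)) x xs (inBBF-false j D a c bs) eq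
          (All.tabulate (λ i∈ → fits-false st _ bs (found i∈)))
          (trans (cong (fitsIn j st (cell c (suc k))) max≡k) (fits-false st k bs (k∈ 1≤k))))
        (cong (λ l → newRegion j c l s st) (trans (cong (λ i → lowestLevel j s (suc i)) max≡k) (lowestLevel-next k k<j)))
        where
        found : ∀ {i} → i ∈ is → i ∈ levelsOf c st
        found = subst (_ ∈_) (sym eq)
        1≤k : 1 ≤ k
        1≤k = let 1≤x , x≤k = bounds (found (here refl)) in ≤-trans 1≤x x≤k
        max≡k : maxList is ≡ k
        max≡k = ≤-antisym (maxList≤ is (λ i∈ → proj₂ (bounds (found i∈)))) (≤maxList (subst (k ∈_) eq (k∈ 1≤k)))

    ladder : ℕ → ℕ → ℕ → ℕ → List Job → List Job
    ladder g c k zero    R = R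
    ladder g c k (suc f) R = job g c (a (suc k)) ∷ ladder g c (suc k) f R

    -- The added volume is 2 ^ (k + 1) + ... + 2 ^ (k + f), a geometric sum written without
    -- truncated subtraction.
    ladder-run : ∀ v g c k f R st → k + f < j → All (BinOK j D a c k) st → (1 ≤ k → HasLevel c k st) →
      Σ State λ st′ → process v j st (toItems D (ladder g c k f R)) ≡ process v j st′ (toItems D R)
        × All (BinOK j D a (suc c) 0) st′ × volume st′ + 2 ^ suc k ≡ 2 ^ suc (k + f) + volume st
    ladder-run v g c k zero R st k<j bs has = st , refl , next-colour j D a bs ,
      trans (+-comm (volume st) (2 ^ suc k)) (cong (λ i → 2 ^ suc i + volume st) (sym (+-identityʳ k)))
    ladder-run v g c k (suc f) R st k+f<j bs has =
      let st₁ = insert j c (suc k) (a (suc k) ÷ D) st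
          k+f<j′ = subst (_< j) (+-suc k f) k+f<j
          sk<j = ≤-trans (s≤s (s≤s (m≤m+n k f))) k+f<j′
          st′ , eq , bs′ , vol = ladder-run v g c (suc k) f R st₁ k+f<j′
            (insert-ok j D a st (<⇒≤ sk<j) bs) (λ _ → HasLevel-insert j c (suc k) _ st)
      in st′ ,
         trans (process-∷ v j st _ _) (trans (cong (λ s → process v j s (toItems D (ladder g c (suc k) f R))) (step-cell v c k st sk<j bs has)) eq) ,
         bs′ ,
         +-cancelʳ-≡ (2 ^ suc k) _ _ (begin
           volume st′ + 2 ^ suc k + 2 ^ suc k      ≡⟨ double (volume st′) (2 ^ suc k) ⟩
           volume st′ + 2 ^ suc (suc k)            ≡⟨ vol ⟩
           2 ^ suc (suc k + f) + volume st₁        ≡⟨ cong₂ _+_ (cong (λ i → 2 ^ suc i) (sym (+-suc k f))) (volume-insert j c (suc k) _ st) ⟩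
           2 ^ suc (k + suc f) + (2 ^ suc k + volume st) ≡⟨ swap (2 ^ suc (k + suc f)) (2 ^ suc k) (volume st) ⟩
           2 ^ suc (k + suc f) + volume st + 2 ^ suc k   ∎)
      where
      open ≡-Reasoning
      double : ∀ x y → x + y + y ≡ x + 2 * y
      double = solve-∀
      swap : ∀ x y z → x + (y + z) ≡ x + z + y
      swap = solve-∀

-- The instance for the factor 3

module LadderInstance where
  open import Data.Nat
  open import Data.Nat.Properties
  import Data.Rational.Properties as ℚₚ
  open import Data.List using (List; []; _∷_; length)
  open import Data.List.Relation.Unary.All as All using (All; []; _∷_)
  open import Data.Product using (Σ; _×_; _,_; proj₁)
  open import Data.Unit using (tt)
  open import Relation.Binary.PropositionalEquality
  open import Data.Nat.Tactic.RingSolver using (solve-∀)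
  open Fractions
  open Packings
  open BoundedBestFit using (process; process-[]; process-def)
  open LevelRun

  -- One unit above a third of a region of 2 ^ l * (3 * e) units, except on level 1, where `3 * e`
  -- is ε, the smallest size allowed.
  rung : ℕ → ℕ → ℕ
  rung e 0               = e + 1
  rung e 1               = 3 * e
  rung e l@(suc (suc _)) = 2 ^ l * e + 1

  rung-lower : ∀ e l → 1 ≤ e → 2 ^ l * e + 1 ≤ rung e l
  rung-lower e 0               1≤e = ≤-reflexive (cong (_+ 1) (*-identityˡ e))
  rung-lower e 1               1≤e = ≤-trans (+-monoʳ-≤ (2 * e) 1≤e) (≤-reflexive (+-comm (2 * e) e))
  rung-lower e l@(suc (suc _)) 1≤e = ≤-refl

  -- More than a third of a region on a level above `l` is more than two thirds of a level-l region,
  -- whose own item already takes over a third.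
  rung-overflows : ∀ {e l k} → 1 ≤ e → l ≤ k → 2 ^ l * (3 * e) < rung e l + rung e (suc k)
  rung-overflows {e} {l} {k} 1≤e l≤k = begin-strict
    2 ^ l * (3 * e)                           <⟨ m<m+n (2 ^ l * (3 * e)) {2} (s≤s z≤n) ⟩
    2 ^ l * (3 * e) + 2                       ≡⟨ split (2 ^ l) e ⟩
    2 ^ l * e + 1 + (2 ^ suc l * e + 1)       ≤⟨ +-mono-≤ (rung-lower e l 1≤e) (≤-trans
                                                   (+-monoˡ-≤ 1 (*-monoˡ-≤ e (^-monoʳ-≤ 2 (s≤s l≤k))))
                                                   (rung-lower e (suc k) 1≤e)) ⟩
    rung e l + rung e (suc k)                 ∎
    where
    open ≤-Reasoning
    split : ∀ x e → x * (3 * e) + 2 ≡ x * e + 1 + (2 * x * e + 1)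
    split = solve-∀

  rung-fits : ∀ {e} k → 1 ≤ e → rung e (suc k) ≤ 2 ^ suc k * (3 * e)
  rung-fits {e} zero    1≤e = m≤m+n (3 * e) (3 * e + 0)
  rung-fits {e} (suc k) 1≤e = begin
    x * e + 1                ≤⟨ +-monoʳ-≤ (x * e) (*-mono-≤ (m^n>0 2 (suc (suc k))) (≤-trans 1≤e (m≤m+n e (e + 0)))) ⟩
    x * e + x * (2 * e)      ≡⟨ triple x e ⟩
    x * (3 * e)              ∎
    where
    open ≤-Reasoning
    x = 2 ^ suc (suc k)
    triple : ∀ x e → x * e + x * (2 * e) ≡ x * (3 * e)
    triple = solve-∀

  rung-≥ε : ∀ e k → 3 * e ≤ rung e (suc k)
  rung-≥ε e zero    = ≤-refl
  rung-≥ε e (suc k) = ≤-trans (*-monoˡ-≤ e {3} {2 ^ suc (suc k)} (≤-trans (s≤s (s≤s (s≤s (z≤n {1})))) (^-monoʳ-≤ 2 (s≤s (s≤s (z≤n {k}))))))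
    (m≤m+n (2 ^ suc (suc k) * e) 1)

  rungs : ℕ → ℕ → ℕ → ℕ
  rungs e k zero    = 0
  rungs e k (suc f) = rung e (suc k) + rungs e (suc k) f

  rungs-upper : ∀ e k f → rungs e (suc k) f + 2 ^ (2 + k) * e ≡ 2 ^ (2 + k + f) * e + f
  rungs-upper e k zero    = trans (cong (λ i → 2 ^ (2 + i) * e) (sym (+-identityʳ k))) (sym (+-identityʳ _))
  rungs-upper e k (suc f) = begin
    x * e + 1 + r + x * e             ≡⟨ collect x e r ⟩
    r + 2 * x * e + 1                 ≡⟨ cong (_+ 1) (rungs-upper e (suc k) f) ⟩
    2 ^ (3 + k + f) * e + f + 1       ≡⟨ +-assoc (2 ^ (3 + k + f) * e) f 1 ⟩
    2 ^ (3 + k + f) * e + (f + 1)     ≡⟨ cong₂ _+_ (cong (λ i → 2 ^ (2 + i) * e) (sym (+-suc k f))) (+-comm f 1) ⟩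
    2 ^ (2 + k + suc f) * e + suc f   ∎
    where
    open ≡-Reasoning
    x = 2 ^ (2 + k)
    r = rungs e (suc (suc k)) f
    collect : ∀ x e r → x * e + 1 + r + x * e ≡ r + 2 * x * e + 1
    collect = solve-∀

  -- The powers 2 ^ 2, ..., 2 ^ (e + 1) times e fall short of the total by 4 e; level 1 supplies 3 e
  -- and the one-unit surpluses of the `e` other levels the rest. This is why `e` is both the unit
  -- and the number of those levels.
  rungs-total : ∀ e → rungs e 0 (suc e) ≡ 2 ^ (2 + e) * e
  rungs-total e = +-cancelʳ-≡ (4 * e) _ _ (begin
    3 * e + rungs e 1 e + 4 * e        ≡⟨ +-assoc (3 * e) (rungs e 1 e) (4 * e) ⟩
    3 * e + (rungs e 1 e + 4 * e)      ≡⟨ cong (3 * e +_) (rungs-upper e 0 e) ⟩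
    3 * e + (2 ^ (2 + e) * e + e)      ≡⟨ shuffle e (2 ^ (2 + e) * e) ⟩
    2 ^ (2 + e) * e + 4 * e            ∎)
    where
    open ≡-Reasoning
    shuffle : ∀ e y → 3 * e + (y + e) ≡ y + 4 * e
    shuffle = solve-∀

  module _ (e : ℕ) (1≤e : 1 ≤ e) (v : Variant) where

    j : ℕ
    j = 2 + e

    instance
      D≢0 : NonZero (2 ^ j * (3 * e))
      D≢0 = m*n≢0 (2 ^ j) (3 * e) {{m^n≢0 2 j}} {{m*n≢0 3 e {{_}} {{>-nonZero 1≤e}}}}

    open Levels j (3 * e) (rung e) (rung-overflows 1≤e) (λ k → rung-fits k 1≤e)

    group : ℕ → List Job → List Job
    group g R = ladder g (g * 3) 0 (suc e) (ladder g (1 + g * 3) 0 (suc e) (ladder g (2 + g * 3) 0 (suc e) R))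

    -- The recursion puts the new group at the end, so that colours appear in the increasing order
    -- that `RegionOK` presupposes.
    groups : ℕ → List Job → List Job
    groups zero    R = R
    groups (suc n) R = groups n (group n R)

    weight-ladder : ∀ w g c k f R → weight w (ladder g c k f R) ≡ w g * rungs e k f + weight w R
    weight-ladder w g c k zero    R = cong (_+ weight w R) (sym (*-zeroʳ (w g)))
    weight-ladder w g c k (suc f) R = trans (cong (w g * rung e (suc k) +_) (weight-ladder w g c (suc k) f R))
      (collect (w g) (rung e (suc k)) (rungs e (suc k) f) (weight w R))
      where
      collect : ∀ x y z r → x * y + (x * z + r) ≡ x * (y + z) + r
      collect = solve-∀

    weight-group : ∀ w g R → weight w (group g R) ≡ D * w g + weight w R
    weight-group w g R = begin
      weight w (group g R)                                      ≡⟨ weight-ladder w g _ 0 (suc e) _ ⟩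
      x + weight w (ladder g (1 + g * 3) 0 (suc e) _)           ≡⟨ cong (x +_) (weight-ladder w g _ 0 (suc e) _) ⟩
      x + (x + weight w (ladder g (2 + g * 3) 0 (suc e) R))     ≡⟨ cong (λ r → x + (x + r)) (weight-ladder w g _ 0 (suc e) R) ⟩
      x + (x + (x + weight w R))                                ≡⟨ cong (λ y → w g * y + (w g * y + (w g * y + weight w R))) (rungs-total e) ⟩
      y + (y + (y + weight w R))                                ≡⟨ collect (w g) (2 ^ j) e (weight w R) ⟩
      D * w g + weight w R                                      ∎
      where
      open ≡-Reasoning
      x = w g * rungs e 0 (suc e)
      y = w g * (2 ^ j * e)
      collect : ∀ x y e r → x * (y * e) + (x * (y * e) + (x * (y * e) + r)) ≡ y * (3 * e) * x + r
      collect = solve-∀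

    weight-groups : ∀ w n R → weight w (groups n R) ≡ D * Σ< n w + weight w R
    weight-groups w zero    R = cong (_+ weight w R) (sym (*-zeroʳ D))
    weight-groups w (suc n) R = trans (weight-groups w n (group n R)) (trans (cong (D * Σ< n w +_) (weight-group w n R))
      (collect D (Σ< n w) (w n) (weight w R)))
      where
      collect : ∀ d x y r → d * x + (d * y + r) ≡ d * (x + y) + r
      collect = solve-∀

    InRange : Job → Set
    InRange t = 3 * e ≤ units t × units t ≤ D

    ladder-range : ∀ g c k f R → k + f < j → All InRange R → All InRange (ladder g c k f R)
    ladder-range g c k zero    R k<j rs = rs
    ladder-range g c k (suc f) R k+f<j rs =
      (rung-≥ε e k , ≤-trans (rung-fits k 1≤e) (*-monoˡ-≤ (3 * e) (^-monoʳ-≤ 2 (≤-trans (m≤m+n (suc k) f) (<⇒≤ k+f<j′))))) ∷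
      ladder-range g c (suc k) f R k+f<j′ rs
      where
      k+f<j′ : suc k + f < j
      k+f<j′ = subst (_< j) (+-suc k f) k+f<j

    groups-range : ∀ n R → All InRange R → All InRange (groups n R)
    groups-range zero    R rs = rs
    groups-range (suc n) R rs = groups-range n (group n R)
      (ladder-range n (n * 3) 0 (suc e) _ ≤-refl (ladder-range n (1 + n * 3) 0 (suc e) _ ≤-refl (ladder-range n (2 + n * 3) 0 (suc e) R ≤-refl rs)))

    range⇒SizesIn : ∀ T → All InRange T → SizesIn j (toItems D T)
    range⇒SizesIn []      []               = tt
    range⇒SizesIn (t ∷ T) ((lo , hi) ∷ rs) =
      (ℚₚ.≤-trans (ℚₚ.≤-reflexive (eps-scaled j (3 * e))) (÷-mono-≤ D lo) ,
       ℚₚ.≤-trans (÷-mono-≤ D hi) (ℚₚ.≤-reflexive (d÷d≡1 D))) , range⇒SizesIn T rs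

    ladder-run₀ : ∀ g c R st → All (BinOK j D (rung e) c 0) st →
      Σ State λ st′ → process v j st (toItems D (ladder g c 0 (suc e) R)) ≡ process v j st′ (toItems D R)
        × All (BinOK j D (rung e) (suc c) 0) st′ × volume st′ + 2 ≡ 2 ^ j + volume st
    ladder-run₀ g c R st bs = ladder-run v g c 0 (suc e) R st ≤-refl bs (λ ())

    group-run : ∀ g R st → All (BinOK j D (rung e) (g * 3) 0) st →
      Σ State λ st′ → process v j st (toItems D (group g R)) ≡ process v j st′ (toItems D R)
        × All (BinOK j D (rung e) (suc g * 3) 0) st′ × volume st′ + 6 ≡ 3 * 2 ^ j + volume st
    group-run g R st bs =
      let st₁ , eq₁ , bs₁ , vol₁ = ladder-run₀ g (g * 3) _ st bs
          st₂ , eq₂ , bs₂ , vol₂ = ladder-run₀ g (1 + g * 3) _ st₁ bs₁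
          st₃ , eq₃ , bs₃ , vol₃ = ladder-run₀ g (2 + g * 3) R st₂ bs₂
      in st₃ , trans eq₁ (trans eq₂ eq₃) , bs₃ , (begin
        volume st₃ + 6                        ≡⟨ +-assoc (volume st₃) 2 4 ⟨
        volume st₃ + 2 + 4                    ≡⟨ cong (_+ 4) vol₃ ⟩
        2 ^ j + volume st₂ + 4                ≡⟨ shift (2 ^ j) (volume st₂) ⟩
        2 ^ j + (volume st₂ + 2) + 2          ≡⟨ cong (λ x → 2 ^ j + x + 2) vol₂ ⟩
        2 ^ j + (2 ^ j + volume st₁) + 2      ≡⟨ shift′ (2 ^ j) (volume st₁) ⟩
        2 ^ j + (2 ^ j + (volume st₁ + 2))    ≡⟨ cong (λ x → 2 ^ j + (2 ^ j + x)) vol₁ ⟩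
        2 ^ j + (2 ^ j + (2 ^ j + volume st)) ≡⟨ triple (2 ^ j) (volume st) ⟩
        3 * 2 ^ j + volume st                 ∎)
      where
      open ≡-Reasoning
      shift : ∀ x y → x + y + 4 ≡ x + (y + 2) + 2
      shift = solve-∀
      shift′ : ∀ x y → x + (x + y) + 2 ≡ x + (x + (y + 2))
      shift′ = solve-∀
      triple : ∀ x y → x + (x + (x + y)) ≡ 3 * x + y
      triple = solve-∀

    groups-run : ∀ n R → Σ State λ st → process v j [] (toItems D (groups n R)) ≡ process v j st (toItems D R)
      × All (BinOK j D (rung e) (n * 3) 0) st × volume st + 6 * n ≡ 3 * n * 2 ^ j
    groups-run zero    R = [] , refl , [] , refl
    groups-run (suc n) R =
      let st  , eq  , bs  , vol  = groups-run n (group n R)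
          st′ , eq′ , bs′ , vol′ = group-run n R st bs
      in st′ , trans eq eq′ , bs′ , (begin
        volume st′ + 6 * suc n              ≡⟨ shift (volume st′) n ⟩
        volume st′ + 6 + 6 * n              ≡⟨ cong (_+ 6 * n) vol′ ⟩
        3 * 2 ^ j + volume st + 6 * n       ≡⟨ +-assoc (3 * 2 ^ j) (volume st) (6 * n) ⟩
        3 * 2 ^ j + (volume st + 6 * n)     ≡⟨ cong (3 * 2 ^ j +_) vol ⟩
        3 * 2 ^ j + 3 * n * 2 ^ j           ≡⟨ collect (2 ^ j) n ⟩
        3 * suc n * 2 ^ j                   ∎)
      where
      open ≡-Reasoning
      shift : ∀ x n → x + 6 * suc n ≡ x + 6 + 6 * n
      shift = solve-∀
      collect : ∀ x n → 3 * x + 3 * n * x ≡ 3 * suc n * x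
      collect = solve-∀

    -- Each of the 3 n colours contributes volume 2 ^ j - 2, and a bin holds at most 2 ^ j; the
    -- shortfall from 3 n bins is therefore at most 6 n / 2 ^ j.
    ladder-instance : ∀ n → Σ Instance λ I → SizesIn j I × IsOPT I n × 3 * n * 2 ^ j ≤ 2 ^ j * P v j I + 6 * n
    ladder-instance n = toItems D T₀ , range⇒SizesIn T₀ ranges ,
      perfect⇒OPT D n T₀ (All.map (λ r → ≤-trans (≤-trans 1≤e (m≤m+n e (2 * e))) (proj₁ r)) ranges)
        (λ w → trans (weight-groups w n []) (+-identityʳ (D * Σ< n w))) ,
      bins
      where
      T₀ = groups n []
      ranges = groups-range n [] []
      bins : 3 * n * 2 ^ j ≤ 2 ^ j * P v j (toItems D T₀) + 6 * n
      bins = let open ≤-Reasoning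
                 st , eq , bs , vol = groups-run n []
        in begin
        3 * n * 2 ^ j                            ≡⟨ vol ⟨
        volume st + 6 * n                        ≤⟨ +-monoˡ-≤ (6 * n) (volume-bound j D (rung e) st bs) ⟩
        2 ^ j * length st + 6 * n                ≡⟨ cong (λ s → 2 ^ j * length s + 6 * n)
          (trans (sym (process-[] v j st)) (trans (sym eq) (process-def v j [] (toItems D T₀)))) ⟩
        2 ^ j * P v j (toItems D T₀) + 6 * n     ∎

-- From counts to ratios with slack δ

module Ratios where
  open import Data.Nat
  open import Data.Nat.Properties
  import Data.Integer as ℤ
  open import Data.Rational as ℚ using (ℚ; 0ℚ; 1ℚ; mkℚ; *<*)
  import Data.Rational.Properties as ℚₚ
  open import Data.Product using (Σ; _×_; _,_)
  open import Relation.Binary.PropositionalEquality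
  open import Data.Nat.Tactic.RingSolver using (solve-∀)
  open Fractions

  -- The denominator of δ serves as m, because a positive numerator is at least 1.
  archimedean : ∀ δ → 0ℚ ℚ.< δ → Σ ℕ λ m → 1 ≤ m × 1ℚ ℚ.≤ toℚ m ℚ.* δ
  archimedean (mkℚ (ℤ.+ zero)   d-1 _) (*<* (ℤ.+<+ ()))
  archimedean (mkℚ ℤ.-[1+ n ]   d-1 _) (*<* ())
  archimedean δ@(mkℚ (ℤ.+ suc n) d-1 _) 0<δ = suc d-1 , s≤s z≤n , (begin
    1ℚ                                      ≡⟨ d÷d≡1 d ⟨
    d ÷ d                                   ≤⟨ ÷-mono-≤ d (m≤m*n d (suc n)) ⟩
    (d * suc n) ÷ d                         ≡⟨ ÷-cross (d * suc n) d (d * suc n) (1 * d) (cong (d * suc n *_) (*-identityˡ d)) ⟩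
    (d * suc n) ÷ (1 * d)                   ≡⟨ ÷-* d 1 (suc n) d ⟨
    d ÷ 1 ℚ.* suc n ÷ d                     ≡⟨ cong₂ ℚ._*_ (÷-def d 1) (trans (÷-def (suc n) d) (ℚₚ.↥p/↧p≡p δ)) ⟩
    toℚ d ℚ.* δ                             ∎)
    where
    open ℚₚ.≤-Reasoning
    d = suc d-1

  toℚ-+ : ∀ a b → toℚ a ℚ.+ toℚ b ≡ toℚ (a + b)
  toℚ-+ a b = trans (cong₂ ℚ._+_ (sym (÷-def a 1)) (sym (÷-def b 1))) (trans (÷-+ a b 1) (÷-def (a + b) 1))

  toℚ-* : ∀ a b → toℚ a ℚ.* toℚ b ≡ toℚ (a * b)
  toℚ-* a b = trans (cong₂ ℚ._*_ (sym (÷-def a 1)) (sym (÷-def b 1))) (trans (÷-* a 1 b 1) (÷-def (a * b) 1))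

  toℚ-mono : ∀ {a b} → a ≤ b → toℚ a ℚ.≤ toℚ b
  toℚ-mono {a} {b} a≤b = subst₂ ℚ._≤_ (÷-def a 1) (÷-def b 1) (÷-mono-≤ 1 a≤b)

  toℚ-nonNeg : ∀ a → ℚ.NonNegative (toℚ a)
  toℚ-nonNeg a = ℚ.nonNegative (toℚ-mono {0} {a} z≤n)

  -- K bounds the shortfall of P below (c / d) o; the slack δ o absorbs it once K ≤ o / m.
  ratio-bound : ∀ c d .{{_ : NonZero d}} δ m o P K → 0ℚ ℚ.< δ → 1ℚ ℚ.≤ toℚ m ℚ.* δ →
    c * o ≤ (P + K) * d → K * m ≤ o → ((ℤ.+ c ℚ./ d) ℚ.- δ) ℚ.* toℚ o ℚ.≤ toℚ P
  ratio-bound c d δ m o P K 0<δ 1≤mδ co≤ Km≤o = begin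
    (r ℚ.- δ) ℚ.* toℚ o                         ≡⟨ ℚₚ.*-distribʳ-+ (toℚ o) r (ℚ.- δ) ⟩
    r ℚ.* toℚ o ℚ.+ (ℚ.- δ) ℚ.* toℚ o           ≤⟨ ℚₚ.+-mono-≤ ro≤ -δo≤ ⟩
    toℚ (P + K) ℚ.+ (ℚ.- toℚ K)                 ≡⟨ cong (ℚ._+ (ℚ.- toℚ K)) (toℚ-+ P K) ⟨
    toℚ P ℚ.+ toℚ K ℚ.+ (ℚ.- toℚ K)             ≡⟨ ℚₚ.+-assoc (toℚ P) (toℚ K) (ℚ.- toℚ K) ⟩
    toℚ P ℚ.+ (toℚ K ℚ.+ (ℚ.- toℚ K))           ≡⟨ cong (toℚ P ℚ.+_) (ℚₚ.+-inverseʳ (toℚ K)) ⟩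
    toℚ P ℚ.+ 0ℚ                                ≡⟨ ℚₚ.+-identityʳ (toℚ P) ⟩
    toℚ P                                       ∎
    where
    open ℚₚ.≤-Reasoning
    r = ℤ.+ c ℚ./ d
    instance
      d*1≢0 : NonZero (d * 1)
      d*1≢0 = m*n≢0 d 1
      δ≥0 : ℚ.NonNegative δ
      δ≥0 = ℚ.nonNegative (ℚₚ.<⇒≤ 0<δ)
      K≥0 : ℚ.NonNegative (toℚ K)
      K≥0 = toℚ-nonNeg K
    ro≤ : r ℚ.* toℚ o ℚ.≤ toℚ (P + K)
    ro≤ = begin
      r ℚ.* toℚ o                ≡⟨ cong₂ ℚ._*_ (÷-def c d) (÷-def o 1) ⟨
      c ÷ d ℚ.* o ÷ 1            ≡⟨ ÷-* c d o 1 ⟩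
      (c * o) ÷ (d * 1)          ≤⟨ ÷-mono-≤ (d * 1) co≤ ⟩
      ((P + K) * d) ÷ (d * 1)    ≡⟨ ÷-cross ((P + K) * d) (d * 1) ((P + K) * d) d (cong ((P + K) * d *_) (sym (*-identityʳ d))) ⟩
      ((P + K) * d) ÷ d          ≡⟨ k*d÷d (P + K) d ⟩
      toℚ (P + K)                ∎
    K≤δo : toℚ K ℚ.≤ δ ℚ.* toℚ o
    K≤δo = begin
      toℚ K                      ≡⟨ ℚₚ.*-identityʳ (toℚ K) ⟨
      toℚ K ℚ.* 1ℚ               ≤⟨ ℚₚ.*-monoˡ-≤-nonNeg (toℚ K) 1≤mδ ⟩
      toℚ K ℚ.* (toℚ m ℚ.* δ)    ≡⟨ ℚₚ.*-assoc (toℚ K) (toℚ m) δ ⟨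
      toℚ K ℚ.* toℚ m ℚ.* δ      ≡⟨ cong (ℚ._* δ) (toℚ-* K m) ⟩
      toℚ (K * m) ℚ.* δ          ≤⟨ ℚₚ.*-monoʳ-≤-nonNeg δ (toℚ-mono {K * m} {o} Km≤o) ⟩
      toℚ o ℚ.* δ                ≡⟨ ℚₚ.*-comm (toℚ o) δ ⟩
      δ ℚ.* toℚ o                ∎
    -δo≤ : (ℚ.- δ) ℚ.* toℚ o ℚ.≤ ℚ.- toℚ K
    -δo≤ = ℚₚ.≤-trans (ℚₚ.≤-reflexive (sym (ℚₚ.neg-distribˡ-* δ (toℚ o)))) (ℚₚ.neg-antimono-≤ K≤δo)

  n<2^n : ∀ n → n < 2 ^ n
  n<2^n zero    = s≤s z≤n
  n<2^n (suc n) = ≤-trans (+-mono-≤ (m^n>0 2 n) (n<2^n n)) (≤-reflexive (cong (2 ^ n +_) (sym (+-identityʳ (2 ^ n)))))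

  -- Dividing the second hypothesis by `x` bounds the shortfall by 6 N / x, which is at most N / m.
  shortfall-small : ∀ m x P N → 6 * m ≤ x → 3 * N * x ≤ x * P + 6 * N → (3 * N ∸ P) * m ≤ N
  shortfall-small m x P N 6m≤x bound = *-cancelˡ-≤ 6 (begin
    6 * ((3 * N ∸ P) * m)          ≡⟨ regroup (3 * N ∸ P) m ⟩
    (3 * N ∸ P) * (6 * m)          ≤⟨ *-monoʳ-≤ (3 * N ∸ P) 6m≤x ⟩
    (3 * N ∸ P) * x                ≡⟨ *-distribʳ-∸ x (3 * N) P ⟩
    3 * N * x ∸ P * x              ≤⟨ ∸-monoˡ-≤ (P * x) bound ⟩
    x * P + 6 * N ∸ P * x          ≡⟨ cong (λ y → y + 6 * N ∸ P * x) (*-comm x P) ⟩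
    P * x + 6 * N ∸ P * x          ≡⟨ m+n∸m≡n (P * x) (6 * N) ⟩
    6 * N                          ∎)
    where
    open ≤-Reasoning
    regroup : ∀ k m → 6 * (k * m) ≡ k * (6 * m)
    regroup = solve-∀

  ratio-3 : ∀ v δ m j N → 0ℚ ℚ.< δ → 1ℚ ℚ.≤ toℚ m ℚ.* δ → 6 * m ≤ 2 ^ j →
    (Σ Instance λ I → SizesIn j I × IsOPT I N × 3 * N * 2 ^ j ≤ 2 ^ j * P v j I + 6 * N) →
    Σ Instance λ I → SizesIn j I × Σ ℕ λ o → IsOPT I o × N ≤ o ×
      ((ℤ.+ 3 ℚ./ 1) ℚ.- δ) ℚ.* toℚ o ℚ.≤ toℚ (P v j I)
  ratio-3 v δ m j N 0<δ 1≤mδ 6m≤2^j (I , sizes , opt , bound) = I , sizes , N , opt , ≤-refl ,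
    ratio-bound 3 1 δ m N (P v j I) (3 * N ∸ P v j I) 0<δ 1≤mδ
      (≤-trans (m≤n+m∸n (3 * N) (P v j I)) (≤-reflexive (sym (*-identityʳ (P v j I + (3 * N ∸ P v j I))))))
      (shortfall-small m (2 ^ j) (P v j I) N 6m≤2^j bound)

  ratio-17/10 : ∀ v δ m j N → 0ℚ ℚ.< δ → 1ℚ ℚ.≤ toℚ m ℚ.* δ →
    (Σ Instance λ I → SizesIn j I × IsOPT (colourPart 0 I) (2 + (N + m) * 10) × Pc v j I 0 ≡ 2 + (N + m) * 17) →
    Σ Instance λ I → SizesIn j I × Σ ℕ λ c → Σ ℕ λ o → IsOPT (colourPart c I) o × N ≤ o ×
      ((ℤ.+ 17 ℚ./ 10) ℚ.- δ) ℚ.* toℚ o ℚ.≤ toℚ (Pc v j I c)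
  ratio-17/10 v δ m j N 0<δ 1≤mδ (I , sizes , opt , count) = I , sizes , 0 , 2 + n * 10 , opt ,
    ≤-trans (≤-trans (m≤m+n N m) (m≤m*n n 10)) (m≤n+m (n * 10) 2) ,
    -- 1.7 (2 + 10 n) exceeds 2 + 17 n by 1.4, for which K = 2 is enough.
    ratio-bound 17 10 δ m (2 + n * 10) (Pc v j I 0) 2 0<δ 1≤mδ
      (≤-trans (m≤m+n (17 * (2 + n * 10)) 6) (≤-reflexive (trans (arith n) (cong (λ p → (p + 2) * 10) (sym count)))))
      (≤-trans (≤-trans (*-mono-≤ {2} {10} (s≤s (s≤s z≤n)) (m≤n+m m N)) (≤-reflexive (*-comm 10 n))) (m≤n+m (n * 10) 2))
    where
    -- `N` blocks make OPT large, and `m` more ensure that δ OPT absorbs the constant shortfall 2.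
    n = N + m
    arith : ∀ n → 17 * (2 + n * 10) + 6 ≡ (2 + n * 17 + 2) * 10
    arith = solve-∀

-- Choice of ε and conclusion

open import Data.Nat using (ℕ; _≤_)
open import Data.Integer using (+_)
open import Data.Rational using (ℚ; 0ℚ; _<_; _-_; _*_; _/_) renaming (_≤_ to _≤ℚ_)
open import Data.Product using (Σ; _×_; _,_)
open import Data.List using (List)

theorem6 : (v : Variant) (δ : ℚ) → 0ℚ < δ →
    Σ ℕ λ j → (1 ≤ j) ×
    (((N : ℕ) → Σ Instance λ I → SizesIn j I × Σ ℕ λ o → IsOPT I o × N ≤ o ×
    (((+ 3 / 1) - δ) * toℚ o) ≤ℚ toℚ (P v j I))
    × ((N : ℕ) → Σ Instance λ I → SizesIn j I × Σ ℕ λ c → Σ ℕ λ o →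
    IsOPT (colourPart c I) o × N ≤ o ×
    (((+ 17 / 10) - δ) * toℚ o) ≤ℚ toℚ (Pc v j I c)))
theorem6 v δ 0<δ with Ratios.archimedean δ 0<δ
... | m , 1≤m , 1≤mδ = 2 ℕ.+ e , s≤s z≤n ,
  (λ N → ratio-3 v δ m (2 ℕ.+ e) N 0<δ 1≤mδ (<⇒≤ (<-≤-trans (n<2^n e) (^-monoʳ-≤ 2 (m≤n+m e 2))))
    (LadderInstance.ladder-instance e 1≤e v N)) ,
  (λ N → ratio-17/10 v δ m (2 ℕ.+ e) N 0<δ 1≤mδ
    (BestFitRun.bbf-instance v (2 ℕ.+ e) (N ℕ.+ m) (s≤s (s≤s 1≤e))))
  where
  open Ratios
  open import Data.Nat as ℕ using (s≤s; z≤n)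
  open import Data.Nat.Properties
  -- Then 2 ^ (2 + e) exceeds e = 6 m, so the relative loss 6 / 2 ^ j of the ladder is at most 1 / m
  -- and hence at most δ; and e ≥ 1 gives j ≥ 3, as the other instance requires.
  e = 6 ℕ.* m
  1≤e : 1 ≤ e
  1≤e = ≤-trans 1≤m (m≤m+n m (5 ℕ.* m))
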